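{- For all integers $0\leq k\leq n$, \[ S_1[n,k] = (-1)^{n-k} \sum_{j=0}^{n-k} (-1)^j \binom{n-1+j}{n-k+j} \binom{2n-k}{n-k-j} S_2[n-k+j,j]. \]
   Context: Let $q$ be an indeterminate. For $n\geq 0$ let $\mathfrak{S}_n$ be the set of permutations of $\{1,\dots,n\}$. For $\sigma\in\mathfrak{S}_n$, a right-to-left maximum is an index $i$ such that $\sigma(i)>\sigma(j)$ for all $j$ with $i<j\leq n$; let $\mathrm{rlm}(\sigma)$ be their number. An inversion of $\sigma$ is a pair $(i,j)$ with $1\leq i<j\leq n$ and $\sigma(i)>\sigma(j)$; it is special if there exists $k'$ with $j<k'\leq n$ and $\sigma(i)<\sigma(k')$. Let $\mathrm{inv}'(\sigma)$ be the number of special inversions. For $0\leq k\leq n$, define $S_1[n,k]=\sum_{\sigma} q^{\mathrm{inv}'(\sigma)}$, summed over $\sigma\in\mathfrak{S}_n$ with $\mathrm{rlm}(\sigma)=k$. For a set partition $\pi$ of $\{1,\dots,n\}$, draw an arc $(b_t,b_{t+1})$ for each pair of consecutive elements $b_t<b_{t+1}$ of each block $\{b_1<\dots<b_m\}$. A crossing is a pair of arcs $(a,c),(b,d)$ with $a<b<c<d$; let $\mathrm{cro}(\pi)$ be the number of crossings. For $0\leq k\leq n$, define $S_2[n,k]=\sum_\pi q^{\mathrm{cro}(\pi)}$, summed over set partitions $\pi$ of $\{1,\dots,n\}$ into exactly $k$ blocks (so $S_2[0,0]=1$). -}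

module Defs where

open import Data.Nat using (ℕ; zero; suc; _+_; _∸_; _<ᵇ_; _≡ᵇ_)
open import Data.Bool using (Bool; true; false; if_then_else_; _∧_)
open import Data.List using (List; []; _∷_; [_]; _++_; map; concatMap; length; filterᵇ; all; any; upTo; foldr; cartesianProduct)
open import Data.Product using (_×_; _,_)
open import Data.Integer using (ℤ; +_; -[1+_]) renaming (_+_ to _+ℤ_; _*_ to _*ℤ_; _^_ to _^ℤ_)
open import Data.Nat.Combinatorics using (_C_)

-- Polynomials in q with integer coefficients, represented by their
-- coefficient function (coefficient of q^d).  Two polynomials are equal
-- iff all coefficients agree.

Poly : Set
Poly = ℕ → ℤ

_⊕_ : Poly → Poly → Poly
(f ⊕ g) d = f d +ℤ g d

_⊙_ : ℤ → Poly → Poly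
(c ⊙ f) d = c *ℤ f d

0P : Poly
0P _ = + 0

ΣP : ℕ → (ℕ → Poly) → Poly
ΣP m f = foldr (λ j acc → f j ⊕ acc) 0P (upTo (suc m))

neg1^ : ℕ → ℤ
neg1^ m = -[1+ 0 ] ^ℤ m

-- Permutations of {1,…,n}, as lists σ(1) … σ(n) (one-line notation).
-- All n! permutations, each listed once: insert n+1 at each position.

insertAll : ℕ → List ℕ → List (List ℕ)
insertAll x [] = [ [ x ] ]
insertAll x (y ∷ ys) = (x ∷ y ∷ ys) ∷ map (y ∷_) (insertAll x ys)

perms : ℕ → List (List ℕ)
perms zero = [ [] ]
perms (suc n) = concatMap (insertAll (suc n)) (perms n)

b2n : Bool → ℕ
b2n true = 1
b2n false = 0

rlm : List ℕ → ℕ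
rlm [] = 0
rlm (x ∷ xs) = b2n (all (λ y → y <ᵇ x) xs) + rlm xs

specialFrom : ℕ → List ℕ → ℕ
specialFrom x [] = 0
specialFrom x (y ∷ ys) = b2n ((y <ᵇ x) ∧ any (λ z → x <ᵇ z) ys) + specialFrom x ys

inv′ : List ℕ → ℕ
inv′ [] = 0
inv′ (x ∷ xs) = specialFrom x xs + inv′ xs

-- S₁[n,k] = Σ_{σ ∈ 𝔖ₙ, rlm σ = k} q^{inv′ σ}
S₁ : ℕ → ℕ → Poly
S₁ n k d = + length (filterᵇ (λ σ → (rlm σ ≡ᵇ k) ∧ (inv′ σ ≡ᵇ d)) (perms n))

-- Set partitions of {1,…,n}, as lists of blocks, each block an
-- increasing list.  All partitions, each listed once: the element n+1
-- either forms a new singleton block or is appended to one existing block.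

addEach : ℕ → List (List ℕ) → List (List (List ℕ))
addEach x [] = []
addEach x (b ∷ bs) = ((b ++ [ x ]) ∷ bs) ∷ map (b ∷_) (addEach x bs)

extend : ℕ → List (List ℕ) → List (List (List ℕ))
extend x bs = ([ x ] ∷ bs) ∷ addEach x bs

setPartitions : ℕ → List (List (List ℕ))
setPartitions zero = [ [] ]
setPartitions (suc n) = concatMap (extend (suc n)) (setPartitions n)

blockArcs : List ℕ → List (ℕ × ℕ)
blockArcs [] = []
blockArcs (a ∷ []) = []
blockArcs (a ∷ c ∷ r) = (a , c) ∷ blockArcs (c ∷ r)

arcs : List (List ℕ) → List (ℕ × ℕ)
arcs π = concatMap blockArcs π

crosses : (ℕ × ℕ) × (ℕ × ℕ) → Bool
crosses ((a , c) , (b , d)) = (a <ᵇ b) ∧ (b <ᵇ c) ∧ (c <ᵇ d)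

cro : List (List ℕ) → ℕ
cro π = length (filterᵇ crosses (cartesianProduct (arcs π) (arcs π)))

-- S₂[n,k] = Σ_{π partition of {1..n} with k blocks} q^{cro π}
S₂ : ℕ → ℕ → Poly
S₂ n k d = + length (filterᵇ (λ π → (length π ≡ᵇ k) ∧ (cro π ≡ᵇ d)) (setPartitions n))

{-# OPTIONS --safe #-}
module Submission where

-- Write D for the q-derivative in a variable U, Y for multiplication by 1 + U, X = YD,
-- Z = Y⁻¹ and E = -D.  By the q-Leibniz rule, building set partitions by adding a new largest
-- element (with ∏ (1 + q^x U) over the blocks, x being the number of arcs covering the last
-- element of the block) shows that S₂[m+t,t] is the value at U = 0 of the sum of all words in
-- m letters X and t letters Y applied to 1.  Likewise, building permutations by inserting a new
-- smallest value (with ∏ 1/(1 + q^c U) over the insertion places, c being the number of special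
-- inversions created) shows that S₁[n,n-m] is the value at U = 0 of the sum of all words in m
-- letters E and n-m letters Z applied to 1.  Both sums satisfy, with t = -n for the second, the
-- recurrence H_m(t) = X H_{m-1}(t) + Y H_m(t-1) on all of ℤ, so H_m(t) at U = 0 is a polynomial
-- in t of degree at most 2m.  It vanishes at t = -m, …, -1, and the theorem is Lagrange
-- interpolation at t = -m, …, m, evaluated at t = -n.

-- The constant terms satisfy no closed recurrence: D brings in the next power of U and Y the
-- previous one. Hence whole series are carried, and the degree bound 2m comes from a bound 2m + j
-- for the coefficient of U^j in H_m(t). The vanishing at t = -m, ..., -1 has a simple cause. A word
-- of at most m letters with m letters E either does not exist or is E^m, and E kills the constant
-- 1. A polynomial of degree at most 2m needs 2m + 1 nodes, and -m, ..., m is the choice for which m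
-- of them drop out while the others, t = j with 0 ≤ j ≤ m, give S₂[m+j,j]. So the summation range
-- of the theorem is the set of surviving nodes, and its binomials with their signs are the Lagrange
-- basis polynomials at t = -n.

open import Defs
open import Data.Nat using (ℕ; zero; suc; _≤_; _<_; _+_; _∸_; _*_; _<ᵇ_; _≡ᵇ_; z≤n; s≤s)
open import Data.Nat.Combinatorics using (_C_; nCn≡1; nC1≡n; k>n⇒nCk≡0; nCk+nC[k+1]≡[n+1]C[k+1])
import Data.Nat.Properties as ℕₚ
open import Data.Integer using (ℤ; +_; -[1+_]) renaming (_+_ to _+ℤ_; _*_ to _*ℤ_; _-_ to _-ℤ_; -_ to -ℤ_)
import Data.Integer.Properties as ℤₚ
open import Data.Integer.Tactic.RingSolver using (solve-∀)
open import Data.Nat.Tactic.RingSolver using () renaming (solve-∀ to solve-∀ℕ)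
open import Data.Bool using (Bool; true; false; if_then_else_; not; _∧_; _∨_)
open import Data.List using (List; []; _∷_; [_]; _++_; map; concatMap; length; filterᵇ; all; any; upTo; applyUpTo; foldr; cartesianProduct)
open import Data.Product using (_×_; _,_; proj₁; proj₂)
open import Data.List.Relation.Unary.All using (All; []; _∷_) renaming (map to All-map; zip to All-zip)
open import Data.List.Relation.Unary.All.Properties using () renaming (++⁺ to All-++⁺; map⁺ to All-map⁺)
import Data.List.Properties as Listₚ
open import Data.List.Relation.Unary.AllPairs using (AllPairs; []; _∷_)
open import Data.List.Relation.Binary.Permutation.Propositional using (_↭_; refl; prep; swap) renaming (trans to ↭-step)
open import Data.List.Relation.Binary.Permutation.Propositional.Properties using (↭-length; ++⁺ˡ; shift)
open import Function using (_∘_; id)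
open import Relation.Binary.PropositionalEquality using (_≡_; _≗_; refl; sym; trans; cong; cong₂; subst; module ≡-Reasoning)

-- Finite sums

Σ∈ : {A : Set} → List A → (A → ℤ) → ℤ
Σ∈ [] f = + 0
Σ∈ (x ∷ xs) f = f x +ℤ Σ∈ xs f

Σ< : ℕ → (ℕ → ℤ) → ℤ
Σ< zero f = + 0
Σ< (suc n) f = f 0 +ℤ Σ< n (f ∘ suc)

when : Bool → ℤ → ℤ
when b z = if b then z else + 0

+-interchange : ∀ a b c d → (a +ℤ b) +ℤ (c +ℤ d) ≡ (a +ℤ c) +ℤ (b +ℤ d)
+-interchange = solve-∀

+-left-comm : ∀ a b c → a +ℤ (b +ℤ c) ≡ b +ℤ (a +ℤ c)
+-left-comm = solve-∀

neg-distrib-minus : ∀ a b → -ℤ (a -ℤ b) ≡ (-ℤ a) -ℤ (-ℤ b)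
neg-distrib-minus = solve-∀

module _ {A : Set} where

  Σ∈-cong : ∀ (xs : List A) {f g} → (∀ x → f x ≡ g x) → Σ∈ xs f ≡ Σ∈ xs g
  Σ∈-cong [] h = refl
  Σ∈-cong (x ∷ xs) h = cong₂ _+ℤ_ (h x) (Σ∈-cong xs h)

  Σ∈-cong-All : ∀ {xs : List A} {f g} → All (λ x → f x ≡ g x) xs → Σ∈ xs f ≡ Σ∈ xs g
  Σ∈-cong-All [] = refl
  Σ∈-cong-All (h ∷ hs) = cong₂ _+ℤ_ h (Σ∈-cong-All hs)

  Σ∈-zero : ∀ (xs : List A) → Σ∈ xs (λ _ → + 0) ≡ + 0
  Σ∈-zero [] = refl
  Σ∈-zero (x ∷ xs) = trans (ℤₚ.+-identityˡ _) (Σ∈-zero xs)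

  Σ∈-+ : ∀ (xs : List A) f g → Σ∈ xs (λ x → f x +ℤ g x) ≡ Σ∈ xs f +ℤ Σ∈ xs g
  Σ∈-+ [] f g = refl
  Σ∈-+ (x ∷ xs) f g = trans (cong (f x +ℤ g x +ℤ_) (Σ∈-+ xs f g)) (+-interchange (f x) (g x) (Σ∈ xs f) (Σ∈ xs g))

  Σ∈-neg : ∀ (xs : List A) f → Σ∈ xs (λ x → -ℤ (f x)) ≡ -ℤ (Σ∈ xs f)
  Σ∈-neg [] f = refl
  Σ∈-neg (x ∷ xs) f = trans (cong (-ℤ f x +ℤ_) (Σ∈-neg xs f)) (sym (ℤₚ.neg-distrib-+ (f x) (Σ∈ xs f)))

  Σ∈-minus : ∀ (xs : List A) f g → Σ∈ xs (λ x → f x -ℤ g x) ≡ Σ∈ xs f -ℤ Σ∈ xs g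
  Σ∈-minus xs f g = trans (Σ∈-+ xs f (λ x → -ℤ (g x))) (cong (Σ∈ xs f +ℤ_) (Σ∈-neg xs g))

  Σ∈-++ : ∀ (xs ys : List A) f → Σ∈ (xs ++ ys) f ≡ Σ∈ xs f +ℤ Σ∈ ys f
  Σ∈-++ [] ys f = sym (ℤₚ.+-identityˡ _)
  Σ∈-++ (x ∷ xs) ys f = trans (cong (f x +ℤ_) (Σ∈-++ xs ys f)) (sym (ℤₚ.+-assoc (f x) _ _))

  Σ∈-map : ∀ {B : Set} (h : B → A) (xs : List B) f → Σ∈ (map h xs) f ≡ Σ∈ xs (f ∘ h)
  Σ∈-map h [] f = refl
  Σ∈-map h (x ∷ xs) f = cong (f (h x) +ℤ_) (Σ∈-map h xs f)

  Σ∈-concatMap : ∀ {B : Set} (h : B → List A) (xs : List B) f →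
    Σ∈ (concatMap h xs) f ≡ Σ∈ xs (λ x → Σ∈ (h x) f)
  Σ∈-concatMap h [] f = refl
  Σ∈-concatMap h (x ∷ xs) f = trans (Σ∈-++ (h x) _ f) (cong (Σ∈ (h x) f +ℤ_) (Σ∈-concatMap h xs f))

  Σ∈-when : ∀ b (xs : List A) f → Σ∈ xs (λ x → when b (f x)) ≡ when b (Σ∈ xs f)
  Σ∈-when true xs f = refl
  Σ∈-when false xs f = Σ∈-zero xs

  Σ∈-indicator : ∀ (p : A → Bool) (xs : List A) →
    + length (filterᵇ p xs) ≡ Σ∈ xs (λ x → + b2n (p x))
  Σ∈-indicator p [] = refl
  Σ∈-indicator p (x ∷ xs) with p x
  ... | true = cong (+ 1 +ℤ_) (Σ∈-indicator p xs)
  ... | false = trans (Σ∈-indicator p xs) (sym (ℤₚ.+-identityˡ _))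

  Σ∈-applyUpTo : ∀ (h : ℕ → A) n f → Σ∈ (applyUpTo h n) f ≡ Σ< n (f ∘ h)
  Σ∈-applyUpTo h zero f = refl
  Σ∈-applyUpTo h (suc n) f = cong (f (h 0) +ℤ_) (Σ∈-applyUpTo (h ∘ suc) n f)

All-concatMap : {A B : Set} {P : A → Set} {Q : B → Set} {h : A → List B} →
  (∀ {x} → P x → All Q (h x)) → ∀ {xs} → All P xs → All Q (concatMap h xs)
All-concatMap f [] = []
All-concatMap f (p ∷ ps) = All-++⁺ (f p) (All-concatMap f ps)

≡ᵇ-refl : ∀ n → (n ≡ᵇ n) ≡ true
≡ᵇ-refl zero = refl
≡ᵇ-refl (suc n) = ≡ᵇ-refl n

+≢ᵇ : ∀ k n → (suc k + n ≡ᵇ n) ≡ false × (n ≡ᵇ suc k + n) ≡ false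
+≢ᵇ k zero = refl , refl
+≢ᵇ k (suc n) rewrite ℕₚ.+-suc k n = +≢ᵇ k n

-- Turns a condition on right-to-left maxima or on blocks into one on the complementary statistic,
-- non-maxima or arcs, which counts the letters E or X.
≡ᵇ-complement : ∀ x k {y m} → x + y ≡ k + m → (x ≡ᵇ k) ≡ (y ≡ᵇ m)
≡ᵇ-complement zero zero {y} refl = sym (≡ᵇ-refl y)
≡ᵇ-complement zero (suc k) {m = m} refl = sym (proj₁ (+≢ᵇ k m))
≡ᵇ-complement (suc x) zero {y} refl = sym (proj₂ (+≢ᵇ x y))
≡ᵇ-complement (suc x) (suc k) e = ≡ᵇ-complement x k (ℕₚ.suc-injective e)

b2n-∧ : ∀ b c → + b2n (b ∧ c) ≡ when b (+ b2n c)
b2n-∧ true c = refl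
b2n-∧ false c = refl

Σ<-cong< : ∀ n {f g} → (∀ i → i < n → f i ≡ g i) → Σ< n f ≡ Σ< n g
Σ<-cong< zero h = refl
Σ<-cong< (suc n) h = cong₂ _+ℤ_ (h 0 (s≤s z≤n)) (Σ<-cong< n (λ i i<n → h (suc i) (s≤s i<n)))

Σ<-cong : ∀ n {f g} → (∀ i → f i ≡ g i) → Σ< n f ≡ Σ< n g
Σ<-cong n h = Σ<-cong< n (λ i _ → h i)

Σ<-zero : ∀ n → Σ< n (λ _ → + 0) ≡ + 0
Σ<-zero zero = refl
Σ<-zero (suc n) = trans (ℤₚ.+-identityˡ _) (Σ<-zero n)

Σ<-+ : ∀ n f g → Σ< n (λ i → f i +ℤ g i) ≡ Σ< n f +ℤ Σ< n g
Σ<-+ zero f g = refl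
Σ<-+ (suc n) f g = trans (cong (f 0 +ℤ g 0 +ℤ_) (Σ<-+ n (f ∘ suc) (g ∘ suc)))
  (+-interchange (f 0) (g 0) (Σ< n (f ∘ suc)) (Σ< n (g ∘ suc)))

Σ<-neg : ∀ n f → Σ< n (λ i → -ℤ (f i)) ≡ -ℤ (Σ< n f)
Σ<-neg zero f = refl
Σ<-neg (suc n) f = trans (cong (-ℤ f 0 +ℤ_) (Σ<-neg n (f ∘ suc))) (sym (ℤₚ.neg-distrib-+ (f 0) (Σ< n (f ∘ suc))))

Σ<-minus : ∀ n f g → Σ< n (λ i → f i -ℤ g i) ≡ Σ< n f -ℤ Σ< n g
Σ<-minus n f g = trans (Σ<-+ n f (λ i → -ℤ (g i))) (cong (Σ< n f +ℤ_) (Σ<-neg n g))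

Σ<-*ˡ : ∀ n c f → Σ< n (λ i → c *ℤ f i) ≡ c *ℤ Σ< n f
Σ<-*ˡ zero c f = sym (ℤₚ.*-zeroʳ c)
Σ<-*ˡ (suc n) c f = trans (cong (c *ℤ f 0 +ℤ_) (Σ<-*ˡ n c (f ∘ suc))) (sym (ℤₚ.*-distribˡ-+ c (f 0) (Σ< n (f ∘ suc))))

Σ<-last : ∀ n f → Σ< (suc n) f ≡ Σ< n f +ℤ f n
Σ<-last zero f = ℤₚ.+-comm (f 0) _
Σ<-last (suc n) f = trans (cong (f 0 +ℤ_) (Σ<-last n (f ∘ suc))) (sym (ℤₚ.+-assoc (f 0) _ _))

Σ<-split : ∀ m n f → Σ< (m + n) f ≡ Σ< m f +ℤ Σ< n (λ i → f (m + i))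
Σ<-split zero n f = sym (ℤₚ.+-identityˡ _)
Σ<-split (suc m) n f = trans (cong (f 0 +ℤ_) (Σ<-split m n (f ∘ suc))) (sym (ℤₚ.+-assoc (f 0) _ _))

Σ<-reverse : ∀ n f → Σ< (suc n) f ≡ Σ< (suc n) (λ i → f (n ∸ i))
Σ<-reverse zero f = refl
Σ<-reverse (suc n) f = trans (Σ<-last (suc n) f)
  (trans (ℤₚ.+-comm _ (f (suc n))) (cong (f (suc n) +ℤ_) (Σ<-reverse n f)))

-- Newton and Lagrange interpolation

Δ : (ℕ → ℤ) → ℕ → ℤ
Δ u x = u (suc x) -ℤ u x

Δ^ : ℕ → (ℕ → ℤ) → ℕ → ℤ
Δ^ zero u = u
Δ^ (suc p) u = Δ^ p (Δ u)

Δ^-suc : ∀ p u x → Δ^ (suc p) u x ≡ Δ^ p u (suc x) -ℤ Δ^ p u x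
Δ^-suc zero u x = refl
Δ^-suc (suc p) u x = Δ^-suc p (Δ u) x

pascal : ∀ n k → + (suc n C suc k) ≡ + (n C k) +ℤ + (n C suc k)
pascal n k = trans (cong +_ (sym (nCk+nC[k+1]≡[n+1]C[k+1] n k))) (ℤₚ.pos-+ (n C k) _)

-- Induction on N for u and `Δ u` at once, as u (N + 1) = u N + Δ u N. The last term of the second
-- sum contains the difference of order M + 1 and vanishes; Pascal's rule merges the rest.
newton : ∀ M u → (∀ x → Δ^ (suc M) u x ≡ + 0) → ∀ N →
  u N ≡ Σ< (suc M) (λ p → + (N C p) *ℤ Δ^ p u 0)
newton M u h zero = sym (begin
  + 1 *ℤ u 0 +ℤ Σ< M (λ p → + 0 *ℤ Δ^ (suc p) u 0)
    ≡⟨ cong₂ _+ℤ_ (ℤₚ.*-identityˡ (u 0)) (trans (Σ<-cong M (λ p → ℤₚ.*-zeroˡ (Δ^ (suc p) u 0))) (Σ<-zero M)) ⟩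
  u 0 +ℤ + 0 ≡⟨ ℤₚ.+-identityʳ _ ⟩
  u 0 ∎)
  where open ≡-Reasoning
newton M u h (suc N) = begin
  u (suc N)
    ≡⟨ split (u (suc N)) (u N) ⟩
  u N +ℤ Δ u N
    ≡⟨ cong₂ _+ℤ_ (newton M u h N) (newton M (Δ u) h′ N) ⟩
  Σ< (suc M) (λ p → + (N C p) *ℤ d p) +ℤ Σ< (suc M) (λ p → + (N C p) *ℤ d (suc p))
    ≡⟨ cong (Σ< (suc M) (λ p → + (N C p) *ℤ d p) +ℤ_)
        (trans (Σ<-last M (λ p → + (N C p) *ℤ d (suc p)))
          (trans (cong (λ z → s +ℤ + (N C M) *ℤ z) (h 0))
            (trans (cong (s +ℤ_) (ℤₚ.*-zeroʳ (+ (N C M)))) (ℤₚ.+-identityʳ s)))) ⟩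
  (+ 1 *ℤ d 0 +ℤ Σ< M (λ p → + (N C suc p) *ℤ d (suc p))) +ℤ Σ< M (λ p → + (N C p) *ℤ d (suc p))
    ≡⟨ ℤₚ.+-assoc (+ 1 *ℤ d 0) _ _ ⟩
  + 1 *ℤ d 0 +ℤ (Σ< M (λ p → + (N C suc p) *ℤ d (suc p)) +ℤ Σ< M (λ p → + (N C p) *ℤ d (suc p)))
    ≡⟨ cong (+ 1 *ℤ d 0 +ℤ_) (sym (Σ<-+ M (λ p → + (N C suc p) *ℤ d (suc p)) (λ p → + (N C p) *ℤ d (suc p)))) ⟩
  + 1 *ℤ d 0 +ℤ Σ< M (λ p → + (N C suc p) *ℤ d (suc p) +ℤ + (N C p) *ℤ d (suc p))
    ≡⟨ cong (+ 1 *ℤ d 0 +ℤ_) (Σ<-cong M (λ p → trans (collect (+ (N C p)) (+ (N C suc p)) (d (suc p)))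
        (cong (_*ℤ d (suc p)) (sym (pascal N p))))) ⟩
  + 1 *ℤ d 0 +ℤ Σ< M (λ p → + (suc N C suc p) *ℤ d (suc p)) ∎
  where
  open ≡-Reasoning
  d : ℕ → ℤ
  d p = Δ^ p u 0
  s : ℤ
  s = Σ< M (λ p → + (N C p) *ℤ d (suc p))
  split : ∀ a b → a ≡ b +ℤ (a -ℤ b)
  split = solve-∀
  collect : ∀ a b x → b *ℤ x +ℤ a *ℤ x ≡ (a +ℤ b) *ℤ x
  collect = solve-∀
  h′ : ∀ x → Δ^ (suc M) (Δ u) x ≡ + 0
  h′ x = trans (Δ^-suc (suc M) u x) (cong₂ _-ℤ_ (h (suc x)) (h x))

absorption : ∀ n k → suc k * (suc n C suc k) ≡ suc n * (n C k)
absorption zero zero = refl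
absorption zero (suc k) = ℕₚ.*-zeroʳ (suc (suc k))
absorption (suc n) zero = begin
  1 * (suc (suc n) C 1) ≡⟨ ℕₚ.*-identityˡ _ ⟩
  suc (suc n) C 1       ≡⟨ nC1≡n (suc (suc n)) ⟩
  suc (suc n)           ≡⟨ ℕₚ.*-identityʳ _ ⟨
  suc (suc n) * 1       ∎
  where open ≡-Reasoning
absorption (suc n) (suc k) = begin
  suc (suc k) * (suc (suc n) C suc (suc k))
    ≡⟨ cong (suc (suc k) *_) (sym (nCk+nC[k+1]≡[n+1]C[k+1] (suc n) (suc k))) ⟩
  suc (suc k) * (c + (suc n C suc (suc k)))
    ≡⟨ ℕₚ.*-distribˡ-+ (suc (suc k)) c _ ⟩
  (c + suc k * c) + suc (suc k) * (suc n C suc (suc k))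
    ≡⟨ cong₂ (λ y z → (c + y) + z) (absorption n k) (absorption n (suc k)) ⟩
  (c + suc n * (n C k)) + suc n * (n C suc k)
    ≡⟨ ℕₚ.+-assoc c _ _ ⟩
  c + (suc n * (n C k) + suc n * (n C suc k))
    ≡⟨ cong (λ z → c + z) (sym (ℕₚ.*-distribˡ-+ (suc n) (n C k) _)) ⟩
  c + suc n * ((n C k) + (n C suc k))
    ≡⟨ cong (λ z → c + suc n * z) (nCk+nC[k+1]≡[n+1]C[k+1] n k) ⟩
  suc (suc n) * c ∎
  where
  open ≡-Reasoning
  c = suc n C suc k

-- After multiplication by `suc i`, absorption lowers all indices by one on both sides.
trinomial-revision : ∀ i {n m} → i ≤ m → m ≤ n → (n C m) * (m C i) ≡ (n C i) * ((n ∸ i) C (m ∸ i))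
trinomial-revision zero {n} {m} _ _ = trans (ℕₚ.*-identityʳ _) (sym (ℕₚ.*-identityˡ _))
trinomial-revision (suc i) {suc n} {suc m} (s≤s i≤m) (s≤s m≤n) = ℕₚ.*-cancelˡ-≡ _ _ (suc i) (begin
  suc i * ((suc n C suc m) * (suc m C suc i))
    ≡⟨ x*[y*z] (suc i) (suc n C suc m) _ ⟩
  (suc n C suc m) * (suc i * (suc m C suc i))
    ≡⟨ cong ((suc n C suc m) *_) (absorption m i) ⟩
  (suc n C suc m) * (suc m * (m C i))
    ≡⟨ x*[y*z] (suc n C suc m) (suc m) _ ⟩
  suc m * ((suc n C suc m) * (m C i))
    ≡⟨ ℕₚ.*-assoc (suc m) (suc n C suc m) _ ⟨
  (suc m * (suc n C suc m)) * (m C i)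
    ≡⟨ cong (_* (m C i)) (absorption n m) ⟩
  (suc n * (n C m)) * (m C i)
    ≡⟨ ℕₚ.*-assoc (suc n) (n C m) _ ⟩
  suc n * ((n C m) * (m C i))
    ≡⟨ cong (suc n *_) (trinomial-revision i i≤m m≤n) ⟩
  suc n * ((n C i) * r)
    ≡⟨ ℕₚ.*-assoc (suc n) (n C i) _ ⟨
  (suc n * (n C i)) * r
    ≡⟨ cong (_* r) (sym (absorption n i)) ⟩
  (suc i * (suc n C suc i)) * r
    ≡⟨ ℕₚ.*-assoc (suc i) (suc n C suc i) _ ⟩
  suc i * ((suc n C suc i) * r) ∎)
  where
  open ≡-Reasoning
  r = (n ∸ i) C (m ∸ i)
  x*[y*z] : ∀ x y z → x * (y * z) ≡ y * (x * z)
  x*[y*z] = solve-∀ℕ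

alternating-sum : ℕ → (ℕ → ℤ) → ℤ
alternating-sum p u = Σ< (suc p) (λ i → neg1^ i *ℤ + (p C i) *ℤ u i)

-- Pascal's rule splits the sum into one over u and one over the shift of u, with opposite signs.
alternating-sum-suc : ∀ p u → alternating-sum (suc p) u ≡ -ℤ (alternating-sum p (Δ u))
alternating-sum-suc p u = begin
  head +ℤ Σ< (suc p) (λ i → neg1^ (suc i) *ℤ + (suc p C suc i) *ℤ u (suc i))
    ≡⟨ cong (head +ℤ_) (Σ<-cong (suc p) (λ i → trans
        (cong (λ z → neg1^ (suc i) *ℤ z *ℤ u (suc i)) (pascal p i))
        (split (neg1^ i) (+ (p C i)) (+ (p C suc i)) (u (suc i))))) ⟩
  head +ℤ Σ< (suc p) (λ i → g (suc i) -ℤ h i)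
    ≡⟨ cong (head +ℤ_) (Σ<-minus (suc p) (g ∘ suc) h) ⟩
  head +ℤ (Σ< (suc p) (g ∘ suc) -ℤ Σ< (suc p) h)
    ≡⟨ ℤₚ.+-assoc head (Σ< (suc p) (g ∘ suc)) (-ℤ Σ< (suc p) h) ⟨
  Σ< (suc (suc p)) g -ℤ Σ< (suc p) h
    ≡⟨ cong (_-ℤ Σ< (suc p) h) (Σ<-last (suc p) g) ⟩
  (Σ< (suc p) g +ℤ neg1^ (suc p) *ℤ + (p C suc p) *ℤ u (suc p)) -ℤ Σ< (suc p) h
    ≡⟨ cong (λ z → (Σ< (suc p) g +ℤ neg1^ (suc p) *ℤ + z *ℤ u (suc p)) -ℤ Σ< (suc p) h)
         (k>n⇒nCk≡0 (ℕₚ.n<1+n p)) ⟩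
  (Σ< (suc p) g +ℤ neg1^ (suc p) *ℤ + 0 *ℤ u (suc p)) -ℤ Σ< (suc p) h
    ≡⟨ drop (Σ< (suc p) g) (Σ< (suc p) h) (neg1^ (suc p)) (u (suc p)) ⟩
  -ℤ (Σ< (suc p) h -ℤ Σ< (suc p) g)
    ≡⟨ cong -ℤ_ (sym (Σ<-minus (suc p) h g)) ⟩
  -ℤ Σ< (suc p) (λ i → h i -ℤ g i)
    ≡⟨ cong -ℤ_ (Σ<-cong (suc p) (λ i → factor (neg1^ i *ℤ + (p C i)) (u (suc i)) (u i))) ⟩
  -ℤ alternating-sum p (Δ u) ∎
  where
  open ≡-Reasoning
  head = neg1^ 0 *ℤ + (suc p C 0) *ℤ u 0
  g h : ℕ → ℤ
  g i = neg1^ i *ℤ + (p C i) *ℤ u i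
  h i = neg1^ i *ℤ + (p C i) *ℤ u (suc i)
  split : ∀ s a b x → -[1+ 0 ] *ℤ s *ℤ (a +ℤ b) *ℤ x ≡ -[1+ 0 ] *ℤ s *ℤ b *ℤ x -ℤ s *ℤ a *ℤ x
  split = solve-∀
  drop : ∀ a b s x → (a +ℤ s *ℤ + 0 *ℤ x) -ℤ b ≡ -ℤ (b -ℤ a)
  drop = solve-∀
  factor : ∀ c x y → c *ℤ x -ℤ c *ℤ y ≡ c *ℤ (x -ℤ y)
  factor = solve-∀

Δ^≡alternating-sum : ∀ p u → Δ^ p u 0 ≡ neg1^ p *ℤ alternating-sum p u
Δ^≡alternating-sum zero u = expand (u 0)
  where
  expand : ∀ x → x ≡ + 1 *ℤ (+ 1 *ℤ + 1 *ℤ x +ℤ + 0)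
  expand = solve-∀
Δ^≡alternating-sum (suc p) u = begin
  Δ^ p (Δ u) 0                                    ≡⟨ Δ^≡alternating-sum p (Δ u) ⟩
  neg1^ p *ℤ alternating-sum p (Δ u)              ≡⟨ signs (neg1^ p) (alternating-sum p (Δ u)) ⟩
  neg1^ (suc p) *ℤ (-ℤ alternating-sum p (Δ u))   ≡⟨ cong (neg1^ (suc p) *ℤ_) (sym (alternating-sum-suc p u)) ⟩
  neg1^ (suc p) *ℤ alternating-sum (suc p) u ∎
  where
  open ≡-Reasoning
  signs : ∀ s x → s *ℤ x ≡ -[1+ 0 ] *ℤ s *ℤ (-ℤ x)
  signs = solve-∀

-- For M ≤ N this is u i times the basis polynomial of the nodes 0, ..., M at N: the product of (N -
-- l) / (i - l) over l ≠ i, written with binomial coefficients and the sign (-1)^(M-i).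
lagrange-term : ℕ → ℕ → (ℕ → ℤ) → ℕ → ℤ
lagrange-term N M u i = neg1^ M *ℤ (neg1^ i *ℤ + ((N C i) * ((N ∸ 1 ∸ i) C (M ∸ i))) *ℤ u i)

-- Induction on M for a fixed evaluation point N. The additional Newton term is expanded as an
-- alternating sum, and for u i with i ≤ M the coefficients combine by C(N,M+1) C(M+1,i) - C(N,i)
-- C(N-1-i,M-i) = C(N,i) C(N-1-i,M+1-i), which is trinomial revision followed by Pascal's rule.
newton≡lagrange : ∀ M {N} u → M ≤ N →
  Σ< (suc M) (λ p → + (N C p) *ℤ Δ^ p u 0) ≡ Σ< (suc M) (lagrange-term N M u)
newton≡lagrange zero u _ = expand (u 0)
  where
  expand : ∀ x → + 1 *ℤ x +ℤ + 0 ≡ + 1 *ℤ (+ 1 *ℤ + 1 *ℤ x) +ℤ + 0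
  expand = solve-∀
newton≡lagrange (suc M) {suc N} u (s≤s M≤N) = begin
  Σ< (suc (suc M)) (λ p → + (suc N C p) *ℤ Δ^ p u 0)
    ≡⟨ Σ<-last (suc M) (λ p → + (suc N C p) *ℤ Δ^ p u 0) ⟩
  Σ< (suc M) (λ p → + (suc N C p) *ℤ Δ^ p u 0) +ℤ c *ℤ Δ^ (suc M) u 0
    ≡⟨ cong₂ (λ y z → y +ℤ c *ℤ z) (newton≡lagrange M u (ℕₚ.m≤n⇒m≤1+n M≤N)) (Δ^≡alternating-sum (suc M) u) ⟩
  Σ< (suc M) low +ℤ c *ℤ (s *ℤ Σ< (suc (suc M)) alt)
    ≡⟨ cong (λ z → Σ< (suc M) low +ℤ c *ℤ (s *ℤ z)) (Σ<-last (suc M) alt) ⟩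
  Σ< (suc M) low +ℤ c *ℤ (s *ℤ (Σ< (suc M) alt +ℤ alt (suc M)))
    ≡⟨ distribute (Σ< (suc M) low) c s (Σ< (suc M) alt) (alt (suc M)) ⟩
  (Σ< (suc M) low +ℤ (c *ℤ s) *ℤ Σ< (suc M) alt) +ℤ c *ℤ (s *ℤ alt (suc M))
    ≡⟨ cong (λ z → (Σ< (suc M) low +ℤ z) +ℤ c *ℤ (s *ℤ alt (suc M))) (sym (Σ<-*ˡ (suc M) (c *ℤ s) alt)) ⟩
  (Σ< (suc M) low +ℤ Σ< (suc M) (λ i → (c *ℤ s) *ℤ alt i)) +ℤ c *ℤ (s *ℤ alt (suc M))
    ≡⟨ cong (_+ℤ c *ℤ (s *ℤ alt (suc M))) (sym (Σ<-+ (suc M) low (λ i → (c *ℤ s) *ℤ alt i))) ⟩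
  Σ< (suc M) (λ i → low i +ℤ (c *ℤ s) *ℤ alt i) +ℤ c *ℤ (s *ℤ alt (suc M))
    ≡⟨ cong₂ _+ℤ_ (Σ<-cong< (suc M) inner) outer ⟩
  Σ< (suc M) high +ℤ high (suc M)
    ≡⟨ Σ<-last (suc M) high ⟨
  Σ< (suc (suc M)) high ∎
  where
  open ≡-Reasoning
  c = + (suc N C suc M)
  s = neg1^ (suc M)
  low high alt : ℕ → ℤ
  low = lagrange-term (suc N) M u
  high = lagrange-term (suc N) (suc M) u
  alt i = neg1^ i *ℤ + (suc M C i) *ℤ u i
  distribute : ∀ l c s a b → l +ℤ c *ℤ (s *ℤ (a +ℤ b)) ≡ (l +ℤ (c *ℤ s) *ℤ a) +ℤ c *ℤ (s *ℤ b)
  distribute = solve-∀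
  gather : ∀ s c σ d x l → s *ℤ (σ *ℤ l *ℤ x) +ℤ (c *ℤ (-[1+ 0 ] *ℤ s)) *ℤ (σ *ℤ d *ℤ x)
    ≡ (-[1+ 0 ] *ℤ s) *ℤ (σ *ℤ (c *ℤ d -ℤ l) *ℤ x)
  gather = solve-∀
  cancel : ∀ a b → (a +ℤ b) -ℤ a ≡ b
  cancel = solve-∀
  inner : ∀ i → i < suc M → low i +ℤ (c *ℤ s) *ℤ alt i ≡ high i
  inner i (s≤s i≤M) = trans (gather (neg1^ M) c (neg1^ i) (+ (suc M C i)) (u i) (+ l))
    (cong (λ z → s *ℤ (neg1^ i *ℤ z *ℤ u i)) (begin
      c *ℤ + (suc M C i) -ℤ + l
        ≡⟨ cong (_-ℤ + l) (sym (ℤₚ.pos-* (suc N C suc M) (suc M C i))) ⟩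
      + ((suc N C suc M) * (suc M C i)) -ℤ + l
        ≡⟨ cong (λ z → + z -ℤ + l) (trinomial-revision i (ℕₚ.m≤n⇒m≤1+n i≤M) (s≤s M≤N)) ⟩
      + ((suc N C i) * ((suc N ∸ i) C (suc M ∸ i))) -ℤ + l
        ≡⟨ cong₂ (λ y z → + ((suc N C i) * (y C z)) -ℤ + l)
             (ℕₚ.+-∸-assoc 1 (ℕₚ.≤-trans i≤M M≤N)) (ℕₚ.+-∸-assoc 1 i≤M) ⟩
      + ((suc N C i) * (suc (N ∸ i) C suc (M ∸ i))) -ℤ + l
        ≡⟨ cong (λ z → + ((suc N C i) * z) -ℤ + l) (sym (nCk+nC[k+1]≡[n+1]C[k+1] (N ∸ i) (M ∸ i))) ⟩
      + ((suc N C i) * (((N ∸ i) C (M ∸ i)) + ((N ∸ i) C suc (M ∸ i)))) -ℤ + l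
        ≡⟨ cong (λ z → + z -ℤ + l) (ℕₚ.*-distribˡ-+ (suc N C i) ((N ∸ i) C (M ∸ i)) _) ⟩
      + (l + (suc N C i) * ((N ∸ i) C suc (M ∸ i))) -ℤ + l
        ≡⟨ cong (_-ℤ + l) (ℤₚ.pos-+ l _) ⟩
      (+ l +ℤ + ((suc N C i) * ((N ∸ i) C suc (M ∸ i)))) -ℤ + l
        ≡⟨ cancel (+ l) _ ⟩
      + ((suc N C i) * ((N ∸ i) C suc (M ∸ i)))
        ≡⟨ cong (λ z → + ((suc N C i) * ((N ∸ i) C z))) (sym (ℕₚ.+-∸-assoc 1 i≤M)) ⟩
      + ((suc N C i) * ((N ∸ i) C (suc M ∸ i))) ∎))
    where l = (suc N C i) * ((N ∸ i) C (M ∸ i))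
  regroup : ∀ c s σ x → c *ℤ (s *ℤ (σ *ℤ + 1 *ℤ x)) ≡ s *ℤ (σ *ℤ c *ℤ x)
  regroup = solve-∀
  outer : c *ℤ (s *ℤ alt (suc M)) ≡ high (suc M)
  outer = begin
    c *ℤ (s *ℤ (s *ℤ + (suc M C suc M) *ℤ u (suc M)))
      ≡⟨ cong (λ z → c *ℤ (s *ℤ (s *ℤ + z *ℤ u (suc M)))) (nCn≡1 (suc M)) ⟩
    c *ℤ (s *ℤ (s *ℤ + 1 *ℤ u (suc M)))
      ≡⟨ regroup c s s (u (suc M)) ⟩
    s *ℤ (s *ℤ c *ℤ u (suc M))
      ≡⟨ cong (λ z → s *ℤ (s *ℤ + z *ℤ u (suc M))) (sym (ℕₚ.*-identityʳ (suc N C suc M))) ⟩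
    s *ℤ (s *ℤ + ((suc N C suc M) * ((N ∸ suc M) C 0)) *ℤ u (suc M))
      ≡⟨ cong (λ z → s *ℤ (s *ℤ + ((suc N C suc M) * ((N ∸ suc M) C z)) *ℤ u (suc M))) (sym (ℕₚ.n∸n≡0 M)) ⟩
    high (suc M) ∎

lagrange : ∀ M u → (∀ x → Δ^ (suc M) u x ≡ + 0) → ∀ {N} → M ≤ N →
  u N ≡ Σ< (suc M) (lagrange-term N M u)
lagrange M u h {N} M≤N = trans (newton M u h N) (newton≡lagrange M u M≤N)

-- q-difference operators on coefficient arrays

-- A polynomial f = Σ c_i q^i enters only through the numbers f(a) = Σ c_i φ(i + a) for a fixed
-- φ : ℕ → ℤ, so that multiplication by q^x is f ↦ f(· + x).  A `Series` collects the
-- coefficients (in this form) of the powers U^j of a formal variable U.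
Series : Set
Series = ℕ → ℕ → ℤ

infix 4 _≈_
_≈_ : Series → Series → Set
f ≈ g = ∀ j a → f j a ≡ g j a

0S : Series
0S _ _ = + 0

-- Multiplication by the q-integer [j] = 1 + q + … + q^(j-1).
brk : ℕ → (ℕ → ℤ) → ℕ → ℤ
brk zero f a = + 0
brk (suc j) f a = f a +ℤ brk j f (suc a)

brk-cong : ∀ j {f g} → f ≗ g → brk j f ≗ brk j g
brk-cong zero h a = refl
brk-cong (suc j) h a = cong₂ _+ℤ_ (h a) (brk-cong j h (suc a))

brk-zero : ∀ j a → brk j (λ _ → + 0) a ≡ + 0
brk-zero zero a = refl
brk-zero (suc j) a = trans (ℤₚ.+-identityˡ _) (brk-zero j (suc a))

brk-+ : ∀ j f g a → brk j (λ b → f b +ℤ g b) a ≡ brk j f a +ℤ brk j g a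
brk-+ zero f g a = refl
brk-+ (suc j) f g a = trans (cong (f a +ℤ g a +ℤ_) (brk-+ j f g (suc a)))
  (+-interchange (f a) (g a) (brk j f (suc a)) (brk j g (suc a)))

brk-neg : ∀ j f a → brk j (λ b → -ℤ f b) a ≡ -ℤ brk j f a
brk-neg zero f a = refl
brk-neg (suc j) f a = trans (cong (-ℤ f a +ℤ_) (brk-neg j f (suc a)))
  (sym (ℤₚ.neg-distrib-+ (f a) (brk j f (suc a))))

brk-minus : ∀ j f g a → brk j (λ b → f b -ℤ g b) a ≡ brk j f a -ℤ brk j g a
brk-minus j f g a = trans (brk-+ j f (λ b → -ℤ g b) a) (cong (brk j f a +ℤ_) (brk-neg j g a))

brk-shift : ∀ j f x a → brk j (λ b → f (b + x)) a ≡ brk j f (a + x)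
brk-shift zero f x a = refl
brk-shift (suc j) f x a = cong (f (a + x) +ℤ_) (brk-shift j f x (suc a))

-- The recursion [j+1] = [j] + q^j, while the definition uses [j+1] = 1 + q [j]; the Leibniz rule
-- for `η` takes the q-integer apart at its top power.
brk-last : ∀ j f a → brk (suc j) f a ≡ brk j f a +ℤ f (a + j)
brk-last zero f a = trans (ℤₚ.+-comm (f a) (+ 0)) (cong (λ b → + 0 +ℤ f b) (sym (ℕₚ.+-identityʳ a)))
brk-last (suc j) f a = begin
  f a +ℤ brk (suc j) f (suc a)               ≡⟨ cong (f a +ℤ_) (brk-last j f (suc a)) ⟩
  f a +ℤ (brk j f (suc a) +ℤ f (suc a + j))  ≡⟨ ℤₚ.+-assoc (f a) _ _ ⟨
  brk (suc j) f a +ℤ f (suc a + j)           ≡⟨ cong (λ b → brk (suc j) f a +ℤ f b) (sym (ℕₚ.+-suc a j)) ⟩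
  brk (suc j) f a +ℤ f (a + suc j) ∎
  where open ≡-Reasoning

brk-when : ∀ b j f a → brk j (λ c → when b (f c)) a ≡ when b (brk j f a)
brk-when true j f a = refl
brk-when false j f a = brk-zero j a

brk-Σ : ∀ {A : Set} (xs : List A) j (g : A → ℕ → ℤ) a →
  Σ∈ xs (λ x → brk j (g x) a) ≡ brk j (λ b → Σ∈ xs (λ x → g x b)) a
brk-Σ [] j g a = sym (brk-zero j a)
brk-Σ (x ∷ xs) j g a = trans (cong (brk j (g x) a +ℤ_) (brk-Σ xs j g a))
  (sym (brk-+ j (g x) (λ b → Σ∈ xs (λ y → g y b)) a))

-- Y is multiplication by 1 + U, Z its inverse, D the q-derivative in U, X = YD and E = -D.

D Y X Z E : Series → Series
D f j a = brk (suc j) (f (suc j)) a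
Y f zero a = f zero a
Y f (suc j) a = f (suc j) a +ℤ f j a
X f = Y (D f)
Z f zero a = f zero a
Z f (suc j) a = f (suc j) a -ℤ Z f j a
E f j a = -ℤ D f j a

D-cong : ∀ {f g} → f ≈ g → D f ≈ D g
D-cong h j = brk-cong (suc j) (h (suc j))

Y-cong : ∀ {f g} → f ≈ g → Y f ≈ Y g
Y-cong h zero a = h zero a
Y-cong h (suc j) a = cong₂ _+ℤ_ (h (suc j) a) (h j a)

Z-cong : ∀ {f g} → f ≈ g → Z f ≈ Z g
Z-cong h zero a = h zero a
Z-cong h (suc j) a = cong₂ _-ℤ_ (h (suc j) a) (Z-cong h j a)

D-zero : ∀ {f} → f ≈ 0S → D f ≈ 0S
D-zero h j a = trans (D-cong h j a) (brk-zero (suc j) a)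

Y-zero : ∀ {f} → f ≈ 0S → Y f ≈ 0S
Y-zero h zero a = h zero a
Y-zero h (suc j) a = cong₂ _+ℤ_ (h (suc j) a) (h j a)

Z-zero : ∀ {f} → f ≈ 0S → Z f ≈ 0S
Z-zero h zero a = h zero a
Z-zero h (suc j) a = cong₂ _-ℤ_ (h (suc j) a) (Z-zero h j a)

X-zero : ∀ {f} → f ≈ 0S → X f ≈ 0S
X-zero h = Y-zero (D-zero h)

E-zero : ∀ {f} → f ≈ 0S → E f ≈ 0S
E-zero h j a = cong -ℤ_ (D-zero h j a)

Y∘Z : ∀ f → Y (Z f) ≈ f
Y∘Z f zero a = refl
Y∘Z f (suc j) a = cancel (f (suc j) a) (Z f j a)
  where
  cancel : ∀ x y → (x -ℤ y) +ℤ y ≡ x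
  cancel = solve-∀

Y-+ : ∀ f g → Y (λ j a → f j a +ℤ g j a) ≈ (λ j a → Y f j a +ℤ Y g j a)
Y-+ f g zero a = refl
Y-+ f g (suc j) a = +-interchange (f (suc j) a) (g (suc j) a) (f j a) (g j a)

Y-neg : ∀ f → Y (λ j a → -ℤ f j a) ≈ (λ j a → -ℤ Y f j a)
Y-neg f zero a = refl
Y-neg f (suc j) a = sym (ℤₚ.neg-distrib-+ (f (suc j) a) (f j a))

-- Each operator commutes with Σ_x q^(s x) f x, taken over those x with b x = true.

weighted : {A : Set} → List A → (A → Bool) → (A → ℕ) → (A → Series) → Series
weighted xs b s f j a = Σ∈ xs (λ x → when (b x) (f x j (a + s x)))

when-+ : ∀ b x y → when b (x +ℤ y) ≡ when b x +ℤ when b y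
when-+ true x y = refl
when-+ false x y = refl

when-neg : ∀ b x → when b (-ℤ x) ≡ -ℤ when b x
when-neg true x = refl
when-neg false x = refl

module _ {A : Set} (xs : List A) (b : A → Bool) (s : A → ℕ) (f : A → Series) where

  weighted-D : weighted xs b s (D ∘ f) ≈ D (weighted xs b s f)
  weighted-D j a = trans
    (Σ∈-cong xs (λ x → trans (cong (when (b x)) (sym (brk-shift (suc j) (f x (suc j)) (s x) a)))
      (sym (brk-when (b x) (suc j) (λ c → f x (suc j) (c + s x)) a))))
    (brk-Σ xs (suc j) (λ x c → when (b x) (f x (suc j) (c + s x))) a)

  weighted-E : weighted xs b s (E ∘ f) ≈ E (weighted xs b s f)
  weighted-E j a = trans (Σ∈-cong xs (λ x → when-neg (b x) (D (f x) j (a + s x))))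
    (trans (Σ∈-neg xs (λ x → when (b x) (D (f x) j (a + s x)))) (cong -ℤ_ (weighted-D j a)))

  weighted-Y : weighted xs b s (Y ∘ f) ≈ Y (weighted xs b s f)
  weighted-Y zero a = refl
  weighted-Y (suc j) a = trans (Σ∈-cong xs (λ x → when-+ (b x) (f x (suc j) (a + s x)) (f x j (a + s x))))
    (Σ∈-+ xs (λ x → when (b x) (f x (suc j) (a + s x))) (λ x → when (b x) (f x j (a + s x))))

  weighted-Z : weighted xs b s (Z ∘ f) ≈ Z (weighted xs b s f)
  weighted-Z zero a = refl
  weighted-Z (suc j) a = trans
    (Σ∈-cong xs (λ x → trans (when-+ (b x) (f x (suc j) (a + s x)) (-ℤ Z (f x) j (a + s x)))
      (cong (when (b x) (f x (suc j) (a + s x)) +ℤ_) (when-neg (b x) (Z (f x) j (a + s x))))))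
    (trans (Σ∈-minus xs (λ x → when (b x) (f x (suc j) (a + s x))) (λ x → when (b x) (Z (f x) j (a + s x))))
      (cong (λ z → weighted xs b s f (suc j) a -ℤ z) (weighted-Z j a)))

-- The sum of all words with m letters P and n - m letters Q, applied to v.
words : (P Q : Series → Series) → Series → ℕ → ℕ → Series
words P Q v zero zero = v
words P Q v zero (suc m) = 0S
words P Q v (suc n) zero = Q (words P Q v n zero)
words P Q v (suc n) (suc m) j a = P (words P Q v n m) j a +ℤ Q (words P Q v n (suc m)) j a

-- Too short a word cannot hold m + 1 letters P; at length exactly m + 1 the only word is a power of
-- P, whose innermost letter kills v.
words-zero : ∀ {P Q : Series → Series} {v} →
  (∀ {f} → f ≈ 0S → P f ≈ 0S) → (∀ {f} → f ≈ 0S → Q f ≈ 0S) → P v ≈ 0S →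
  ∀ n m → n ≤ suc m → words P Q v n (suc m) ≈ 0S
words-zero hP hQ hv zero m _ j a = refl
words-zero {P} {Q} {v} hP hQ hv (suc n) m (s≤s n≤m) j a =
  cong₂ _+ℤ_ (first n m n≤m j a) (hQ (words-zero hP hQ hv n m (ℕₚ.m≤n⇒m≤1+n n≤m)) j a)
  where
  first : ∀ n m → n ≤ m → P (words P Q v n m) ≈ 0S
  first zero zero _ = hv
  first n (suc m) n≤1+m = hP (words-zero hP hQ hv n m n≤1+m)

-- The predecessor t - 1, given by cases so that `H` unfolds at `down t`.
down : ℤ → ℤ
down (+ zero) = -[1+ 0 ]
down (+ suc n) = + n
down -[1+ n ] = -[1+ suc n ]

module _ (φ : ℕ → ℤ) where

  one : Series
  one zero a = φ a
  one (suc j) a = + 0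

  D-one : D one ≈ 0S
  D-one j a = brk-zero (suc j) a

  wordsXY-zero : ∀ n m → n ≤ suc m → words X Y one n (suc m) ≈ 0S
  wordsXY-zero = words-zero X-zero Y-zero (Y-zero D-one)

  wordsEZ-zero : ∀ n m → n ≤ suc m → words E Z one n (suc m) ≈ 0S
  wordsEZ-zero = words-zero E-zero Z-zero (λ j a → cong -ℤ_ (D-one j a))

  -- The U-series whose constant terms are S₂[m+t,t] for t ≥ 0 and S₁[-t,-t-m] for t ≤ 0.
  H : ℕ → ℤ → Series
  H m (+ t) = words X Y one (m + t) m
  H m -[1+ n ] = words E Z one (suc n) m

  H-rec-zero : ∀ t → H 0 t ≈ Y (H 0 (down t))
  H-rec-zero (+ zero) j a = sym (Y∘Z one j a)
  H-rec-zero (+ suc t) j a = refl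
  H-rec-zero -[1+ n ] j a = sym (Y∘Z (words E Z one (suc n) 0) j a)

  -- For t > 0 this is the recursion of `words X Y`. For t < 0 it is the recursion of `words E Z`
  -- multiplied by Y, because YE = -X and YZ = 1. At t = 0, where the two families meet, all three
  -- terms vanish.
  H-rec-suc : ∀ m t j a → H (suc m) t j a ≡ X (H m t) j a +ℤ Y (H (suc m) (down t)) j a
  H-rec-suc m (+ zero) j a = trans (wordsXY-zero (suc m + 0) m (ℕₚ.≤-reflexive (ℕₚ.+-identityʳ (suc m))) j a)
    (sym (cong₂ _+ℤ_ (X-H-zero m j a) (Y-zero (wordsEZ-zero 1 m (s≤s z≤n)) j a)))
    where
    X-H-zero : ∀ m → X (H m (+ 0)) ≈ 0S
    X-H-zero zero = Y-zero D-one
    X-H-zero (suc m) = X-zero (wordsXY-zero (suc m + 0) m (ℕₚ.≤-reflexive (ℕₚ.+-identityʳ (suc m))))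
  H-rec-suc m (+ suc t) j a = cong (λ n → X (words X Y one (m + suc t) m) j a +ℤ Y (words X Y one n (suc m)) j a) (ℕₚ.+-suc m t)
  H-rec-suc m -[1+ n ] j a = sym (begin
    X f j a +ℤ Y (λ i b → E f i b +ℤ Z g i b) j a
      ≡⟨ cong (X f j a +ℤ_) (Y-+ (E f) (Z g) j a) ⟩
    X f j a +ℤ (Y (E f) j a +ℤ Y (Z g) j a)
      ≡⟨ cong₂ (λ y z → X f j a +ℤ (y +ℤ z)) (Y-neg (D f) j a) (Y∘Z g j a) ⟩
    X f j a +ℤ (-ℤ X f j a +ℤ g j a)
      ≡⟨ cancel (X f j a) (g j a) ⟩
    g j a ∎)
    where
    open ≡-Reasoning
    f = words E Z one (suc n) m
    g = words E Z one (suc n) (suc m)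
    cancel : ∀ x y → x +ℤ (-ℤ x +ℤ y) ≡ y
    cancel = solve-∀

-- Polynomiality in t, as vanishing of iterated differences

-- The step is downward, f (t - 1) - f t, so that it fits the recurrence of `H` and becomes `Δ`
-- along a descending sequence of nodes.
data Degree< : ℕ → (ℤ → ℤ) → Set where
  zero : ∀ {f} → (∀ t → f t ≡ + 0) → Degree< zero f
  suc : ∀ {d f} → Degree< d (λ t → f (down t) -ℤ f t) → Degree< (suc d) f

Degree<-cong : ∀ {d f g} → (∀ t → f t ≡ g t) → Degree< d f → Degree< d g
Degree<-cong h (zero p) = zero (λ t → trans (sym (h t)) (p t))
Degree<-cong h (suc p) = suc (Degree<-cong (λ t → cong₂ _-ℤ_ (h (down t)) (h t)) p)

Degree<-0 : ∀ d → Degree< d (λ _ → + 0)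
Degree<-0 zero = zero (λ t → refl)
Degree<-0 (suc d) = suc (Degree<-0 d)

Degree<-+ : ∀ {d f g} → Degree< d f → Degree< d g → Degree< d (λ t → f t +ℤ g t)
Degree<-+ (zero p) (zero r) = zero (λ t → cong₂ _+ℤ_ (p t) (r t))
Degree<-+ {suc d} {f} {g} (suc p) (suc r) =
  suc (Degree<-cong (λ t → regroup (f (down t)) (f t) (g (down t)) (g t)) (Degree<-+ p r))
  where
  regroup : ∀ a b c d → (a -ℤ b) +ℤ (c -ℤ d) ≡ (a +ℤ c) -ℤ (b +ℤ d)
  regroup = solve-∀

Degree<-neg : ∀ {d f} → Degree< d f → Degree< d (λ t → -ℤ f t)
Degree<-neg (zero p) = zero (λ t → cong -ℤ_ (p t))
Degree<-neg {suc d} {f} (suc p) =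
  suc (Degree<-cong (λ t → neg-distrib-minus (f (down t)) (f t)) (Degree<-neg p))

Degree<-down : ∀ {d f} → Degree< d f → Degree< d (λ t → f (down t))
Degree<-down (zero p) = zero (λ t → p (down t))
Degree<-down (suc p) = suc (Degree<-down p)

Degree<-suc : ∀ {d f} → Degree< d f → Degree< (suc d) f
Degree<-suc p = suc (Degree<-+ (Degree<-down p) (Degree<-neg p))

Degree<-brk : ∀ d k {f : ℤ → ℕ → ℤ} → (∀ a → Degree< d (λ t → f t a)) → ∀ a → Degree< d (λ t → brk k (f t) a)
Degree<-brk d zero p a = Degree<-0 d
Degree<-brk d (suc k) p a = Degree<-+ (p a) (Degree<-brk d k p (suc a))

double : ℕ → ℕ
double zero = zero
double (suc m) = suc (suc (double m))

module _ (φ : ℕ → ℤ) (m : ℕ) where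

  D-degree : (∀ j a → Degree< (suc (double m + j)) (λ t → H φ m t j a)) →
    ∀ j a → Degree< (suc (suc (double m + j))) (λ t → D (H φ m t) j a)
  D-degree ih j a = subst (λ d → Degree< (suc d) (λ t → D (H φ m t) j a)) (ℕₚ.+-suc (double m) j)
    (Degree<-brk (suc (double m + suc j)) (suc j) (ih (suc j)) a)

  X-degree : (∀ j a → Degree< (suc (double m + j)) (λ t → H φ m t j a)) →
    ∀ j a → Degree< (suc (suc (double m + j))) (λ t → X (H φ m t) j a)
  X-degree ih zero a = D-degree ih zero a
  X-degree ih (suc j) a = Degree<-+ (D-degree ih (suc j) a)
    (subst (λ d → Degree< d (λ t → D (H φ m t) j a)) (sym (ℕₚ.+-suc (suc (suc (double m))) j))
      (Degree<-suc (D-degree ih j a)))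

  -- The expression Y g - g at index j stands for the coefficient j - 1 of g, or 0 if j = 0, so both
  -- cases of j share this step.
  H-degree-suc : ∀ j a → Degree< (double (suc m) + j) (λ t → X (H φ m t) j a) →
    Degree< (double (suc m) + j) (λ t → Y (H φ (suc m) (down t)) j a -ℤ H φ (suc m) (down t) j a) →
    Degree< (suc (double (suc m) + j)) (λ t → H φ (suc m) t j a)
  H-degree-suc j a x y = suc (Degree<-cong
    (λ t → trans (difference (X (H φ m t) j a) (Y (H φ (suc m) (down t)) j a) (H φ (suc m) (down t) j a))
      (cong (λ z → H φ (suc m) (down t) j a -ℤ z) (sym (H-rec-suc φ m t j a))))
    (Degree<-neg (Degree<-+ x y)))
    where
    difference : ∀ x y z → -ℤ (x +ℤ (y -ℤ z)) ≡ z -ℤ (x +ℤ y)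
    difference = solve-∀

-- By the recurrence, the difference in t of the coefficient j consists of the coefficient j of X
-- H_(m-1)(t), which draws on the coefficients j and j + 1 of H_(m-1)(t), and of the coefficient j -
-- 1 of H_m(t - 1). Both have degree at most 2m + j - 1: each X costs two degrees, each power of U
-- one.
H-degree : ∀ φ m j a → Degree< (suc (double m + j)) (λ t → H φ m t j a)
H-degree φ zero zero a = suc (zero (λ t → ℤₚ.i≡j⇒i-j≡0 (sym (H-rec-zero φ t zero a))))
H-degree φ zero (suc j) a = suc (Degree<-cong
  (λ t → trans (difference (H φ 0 (down t) (suc j) a) (H φ 0 (down t) j a))
    (cong (λ z → H φ 0 (down t) (suc j) a -ℤ z) (sym (H-rec-zero φ t (suc j) a))))
  (Degree<-neg (Degree<-down (H-degree φ zero j a))))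
  where
  difference : ∀ x y → -ℤ y ≡ x -ℤ (x +ℤ y)
  difference = solve-∀
H-degree φ (suc m) zero a = H-degree-suc φ m zero a (X-degree φ m (H-degree φ m) zero a)
  (Degree<-cong (λ t → sym (ℤₚ.+-inverseʳ (H φ (suc m) (down t) zero a))) (Degree<-0 (double (suc m) + zero)))
H-degree φ (suc m) (suc j) a = H-degree-suc φ m (suc j) a (X-degree φ m (H-degree φ m) (suc j) a)
  (Degree<-cong (λ t → cancel (H φ (suc m) (down t) (suc j) a) (H φ (suc m) (down t) j a))
    (Degree<-down (subst (λ d → Degree< d (λ t → H φ (suc m) t j a))
      (sym (ℕₚ.+-suc (double (suc m)) j)) (H-degree φ (suc m) j a))))
  where
  cancel : ∀ x y → y ≡ (x +ℤ y) -ℤ x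
  cancel = solve-∀

-- Permutations, built by inserting the smallest value

insertAt : ℕ → ℕ → List ℕ → List ℕ
insertAt p x [] = [ x ]
insertAt zero x (y ∷ ys) = x ∷ y ∷ ys
insertAt (suc p) x (y ∷ ys) = y ∷ insertAt p x ys

Σ-insertAll : ∀ x ys f → Σ∈ (insertAll x ys) f ≡ Σ< (suc (length ys)) (λ p → f (insertAt p x ys))
Σ-insertAll x [] f = refl
Σ-insertAll x (y ∷ ys) f = cong (f (x ∷ y ∷ ys) +ℤ_)
  (trans (Σ∈-map (y ∷_) (insertAll x ys) f) (Σ-insertAll x ys (λ τ → f (y ∷ τ))))

Σ-insertAll-∷ : ∀ x y z ws f → Σ∈ (insertAll x (z ∷ ws)) (λ σ → Σ∈ (insertAll y σ) f) ≡
  (f (y ∷ x ∷ z ∷ ws) +ℤ (f (x ∷ y ∷ z ∷ ws) +ℤ Σ∈ (insertAll y ws) (λ ρ → f (x ∷ z ∷ ρ)))) +ℤ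
  (Σ∈ (insertAll x ws) (λ σ → f (y ∷ z ∷ σ)) +ℤ
   Σ∈ (insertAll x ws) (λ σ → Σ∈ (insertAll y σ) (λ ρ → f (z ∷ ρ))))
Σ-insertAll-∷ x y z ws f = cong₂ _+ℤ_
  (cong (f (y ∷ x ∷ z ∷ ws) +ℤ_) (trans (Σ∈-map (x ∷_) (insertAll y (z ∷ ws)) f)
    (cong (f (x ∷ y ∷ z ∷ ws) +ℤ_) (Σ∈-map (z ∷_) (insertAll y ws) (λ σ → f (x ∷ σ))))))
  (trans (Σ∈-map (z ∷_) (insertAll x ws) (λ σ → Σ∈ (insertAll y σ) f))
    (trans (Σ∈-cong (insertAll x ws) (λ σ → cong (f (y ∷ z ∷ σ) +ℤ_) (Σ∈-map (z ∷_) (insertAll y σ) f)))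
      (Σ∈-+ (insertAll x ws) (λ σ → f (y ∷ z ∷ σ)) (λ σ → Σ∈ (insertAll y σ) (λ ρ → f (z ∷ ρ))))))

-- Both orders of insertion produce the same multiset of lists but enumerate it differently, hence
-- an equality of sums.
Σ-insertAll-comm : ∀ x y ws f →
  Σ∈ (insertAll x ws) (λ σ → Σ∈ (insertAll y σ) f) ≡ Σ∈ (insertAll y ws) (λ σ → Σ∈ (insertAll x σ) f)
Σ-insertAll-comm x y [] f = exchange (f (y ∷ x ∷ [])) (f (x ∷ y ∷ []))
  where
  exchange : ∀ a b → (a +ℤ (b +ℤ + 0)) +ℤ + 0 ≡ (b +ℤ (a +ℤ + 0)) +ℤ + 0
  exchange = solve-∀
Σ-insertAll-comm x y (z ∷ ws) f = begin
  Σ∈ (insertAll x (z ∷ ws)) (λ σ → Σ∈ (insertAll y σ) f)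
    ≡⟨ Σ-insertAll-∷ x y z ws f ⟩
  (a +ℤ (b +ℤ c)) +ℤ (d +ℤ Σ∈ (insertAll x ws) (λ σ → Σ∈ (insertAll y σ) (λ ρ → f (z ∷ ρ))))
    ≡⟨ cong (λ e → (a +ℤ (b +ℤ c)) +ℤ (d +ℤ e)) (Σ-insertAll-comm x y ws (λ ρ → f (z ∷ ρ))) ⟩
  (a +ℤ (b +ℤ c)) +ℤ (d +ℤ e′)
    ≡⟨ exchange a b c d e′ ⟩
  (b +ℤ (a +ℤ d)) +ℤ (c +ℤ e′)
    ≡⟨ Σ-insertAll-∷ y x z ws f ⟨
  Σ∈ (insertAll y (z ∷ ws)) (λ σ → Σ∈ (insertAll x σ) f) ∎
  where
  open ≡-Reasoning
  a = f (y ∷ x ∷ z ∷ ws)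
  b = f (x ∷ y ∷ z ∷ ws)
  c = Σ∈ (insertAll y ws) (λ ρ → f (x ∷ z ∷ ρ))
  d = Σ∈ (insertAll x ws) (λ σ → f (y ∷ z ∷ σ))
  e′ = Σ∈ (insertAll y ws) (λ σ → Σ∈ (insertAll x σ) (λ ρ → f (z ∷ ρ)))
  exchange : ∀ a b c d e → (a +ℤ (b +ℤ c)) +ℤ (d +ℤ e) ≡ (b +ℤ (a +ℤ d)) +ℤ (c +ℤ e)
  exchange = solve-∀

Σ-insertAll-map-suc : ∀ x ys f → Σ∈ (insertAll (suc x) (map suc ys)) f ≡ Σ∈ (insertAll x ys) (f ∘ map suc)
Σ-insertAll-map-suc x [] f = refl
Σ-insertAll-map-suc x (y ∷ ys) f = cong (f (suc x ∷ suc y ∷ map suc ys) +ℤ_) (begin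
  Σ∈ (map (suc y ∷_) (insertAll (suc x) (map suc ys))) f    ≡⟨ Σ∈-map (suc y ∷_) (insertAll (suc x) (map suc ys)) f ⟩
  Σ∈ (insertAll (suc x) (map suc ys)) (λ τ → f (suc y ∷ τ)) ≡⟨ Σ-insertAll-map-suc x ys _ ⟩
  Σ∈ (insertAll x ys) (λ τ → f (map suc (y ∷ τ)))           ≡⟨ Σ∈-map (y ∷_) (insertAll x ys) (f ∘ map suc) ⟨
  Σ∈ (map (y ∷_) (insertAll x ys)) (f ∘ map suc)            ∎)
  where open ≡-Reasoning

-- Values start at 0 here; the shift by `map suc` makes room for a new minimum 0.
insertMin : List ℕ → List (List ℕ)
insertMin σ = insertAll 0 (map suc σ)

minPerms : ℕ → List (List ℕ)
minPerms zero = [ [] ]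
minPerms (suc n) = concatMap insertMin (minPerms n)

-- `perms` inserts maxima while the recurrence needs minima. The two kinds of insertion commute, so
-- the new maximum can be moved inward until it enters the empty list, where it is a minimum as
-- well.
Σ-minPerms-max : ∀ n f → Σ∈ (minPerms n) (λ σ → Σ∈ (insertAll n σ) f) ≡ Σ∈ (minPerms (suc n)) f
Σ-minPerms-max zero f = ℤₚ.+-identityʳ (f [ 0 ] +ℤ + 0)
Σ-minPerms-max (suc n) f = begin
  Σ∈ (minPerms (suc n)) (λ σ → Σ∈ (insertAll (suc n) σ) f)
    ≡⟨ Σ∈-concatMap insertMin (minPerms n) _ ⟩
  Σ∈ (minPerms n) (λ σ → Σ∈ (insertMin σ) (λ τ → Σ∈ (insertAll (suc n) τ) f))
    ≡⟨ Σ∈-cong (minPerms n) (λ σ → trans (Σ-insertAll-comm 0 (suc n) (map suc σ) f)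
        (Σ-insertAll-map-suc n σ (λ τ → Σ∈ (insertAll 0 τ) f))) ⟩
  Σ∈ (minPerms n) (λ σ → Σ∈ (insertAll n σ) (λ τ → Σ∈ (insertMin τ) f))
    ≡⟨ Σ-minPerms-max n (λ τ → Σ∈ (insertMin τ) f) ⟩
  Σ∈ (minPerms (suc n)) (λ τ → Σ∈ (insertMin τ) f)
    ≡⟨ Σ∈-concatMap insertMin (minPerms (suc n)) f ⟨
  Σ∈ (minPerms (suc (suc n))) f ∎
  where open ≡-Reasoning

Σ-perms : ∀ n f → Σ∈ (perms n) f ≡ Σ∈ (minPerms n) (f ∘ map suc)
Σ-perms zero f = refl
Σ-perms (suc n) f = begin
  Σ∈ (perms (suc n)) f
    ≡⟨ Σ∈-concatMap (insertAll (suc n)) (perms n) f ⟩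
  Σ∈ (perms n) (λ σ → Σ∈ (insertAll (suc n) σ) f)
    ≡⟨ Σ-perms n (λ σ → Σ∈ (insertAll (suc n) σ) f) ⟩
  Σ∈ (minPerms n) (λ σ → Σ∈ (insertAll (suc n) (map suc σ)) f)
    ≡⟨ Σ∈-cong (minPerms n) (λ σ → Σ-insertAll-map-suc n σ f) ⟩
  Σ∈ (minPerms n) (λ σ → Σ∈ (insertAll n σ) (f ∘ map suc))
    ≡⟨ Σ-minPerms-max n (f ∘ map suc) ⟩
  Σ∈ (minPerms (suc n)) (f ∘ map suc) ∎
  where open ≡-Reasoning

All-insertAll-length : ∀ x ys → All (λ τ → length τ ≡ suc (length ys)) (insertAll x ys)
All-insertAll-length x [] = refl ∷ []
All-insertAll-length x (y ∷ ys) = refl ∷ All-map⁺ (All-map (cong suc) (All-insertAll-length x ys))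

minPerms-length : ∀ n → All (λ σ → length σ ≡ n) (minPerms n)
minPerms-length zero = refl ∷ []
minPerms-length (suc n) = All-concatMap
  (λ {σ} e → All-map (λ e′ → trans e′ (cong suc (trans (Listₚ.length-map suc σ) e))) (All-insertAll-length 0 (map suc σ)))
  (minPerms-length n)

-- Statistics

nonMaxima : List ℕ → ℕ
nonMaxima [] = 0
nonMaxima (x ∷ xs) = b2n (not (all (λ y → y <ᵇ x) xs)) + nonMaxima xs

-- The effect of a new first entry y on the counters below: y counts at a later place exactly if
-- some entry from there on exceeds it.
bump : ℕ → List ℕ → List ℕ → List ℕ
bump y (z ∷ zs) (c ∷ cs) = (b2n (any (λ x → y <ᵇ x) (z ∷ zs)) + c) ∷ bump y zs cs
bump y _ _ = []

-- The entry at position s counts the special inversions that a new smallest value would form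
-- when inserted at s, that is the i < s such that σ(i) < σ(t) for some t ≥ s.
counters : List ℕ → List ℕ
counters [] = []
counters (y ∷ ys) = 0 ∷ bump y ys (counters ys)

-- A smallest value inserted at p leaves the counters up to p as they are. At all later places it
-- counts itself, since something larger follows, so the counter c at p gives rise to c and c + 1.
-- After an insertion at the end, the additional place has counter 0.
insertCounter : ℕ → List ℕ → List ℕ
insertCounter p [] = [ 0 ]
insertCounter zero (c ∷ cs) = c ∷ suc c ∷ map suc cs
insertCounter (suc p) (c ∷ cs) = c ∷ insertCounter p cs

-- The default 0 is the true value at the place past the end, where no entry follows to make an
-- inversion special.
counterAt : ℕ → List ℕ → ℕ
counterAt p [] = 0
counterAt zero (c ∷ cs) = c
counterAt (suc p) (c ∷ cs) = counterAt p cs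

any-map : ∀ {A B : Set} (q : B → Bool) (f : A → B) xs → any q (map f xs) ≡ any (q ∘ f) xs
any-map q f [] = refl
any-map q f (x ∷ xs) = cong (q (f x) ∨_) (any-map q f xs)

all-map : ∀ {A B : Set} (q : B → Bool) (f : A → B) xs → all q (map f xs) ≡ all (q ∘ f) xs
all-map q f [] = refl
all-map q f (x ∷ xs) = cong (q (f x) ∧_) (all-map q f xs)

any-insertAt : ∀ q p {x} ys → q x ≡ false → any q (insertAt p x ys) ≡ any q ys
any-insertAt q p [] e = cong (_∨ false) e
any-insertAt q zero (y ∷ ys) e = cong (_∨ any q (y ∷ ys)) e
any-insertAt q (suc p) (y ∷ ys) e = cong (q y ∨_) (any-insertAt q p ys e)

all-insertAt : ∀ q p {x} ys → q x ≡ true → all q (insertAt p x ys) ≡ all q ys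
all-insertAt q p [] e = cong (_∧ true) e
all-insertAt q zero (y ∷ ys) e = cong (_∧ all q (y ∷ ys)) e
all-insertAt q (suc p) (y ∷ ys) e = cong (q y ∧_) (all-insertAt q p ys e)

rlm-map-suc : ∀ σ → rlm (map suc σ) ≡ rlm σ
rlm-map-suc [] = refl
rlm-map-suc (x ∷ σ) = cong₂ (λ b n → b2n b + n) (all-map (λ y → y <ᵇ suc x) suc σ) (rlm-map-suc σ)

nonMaxima-map-suc : ∀ σ → nonMaxima (map suc σ) ≡ nonMaxima σ
nonMaxima-map-suc [] = refl
nonMaxima-map-suc (x ∷ σ) =
  cong₂ (λ b n → b2n (not b) + n) (all-map (λ y → y <ᵇ suc x) suc σ) (nonMaxima-map-suc σ)

specialFrom-map-suc : ∀ x σ → specialFrom (suc x) (map suc σ) ≡ specialFrom x σ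
specialFrom-map-suc x [] = refl
specialFrom-map-suc x (y ∷ σ) =
  cong₂ (λ b n → b2n ((y <ᵇ x) ∧ b) + n) (any-map (λ z → suc x <ᵇ z) suc σ) (specialFrom-map-suc x σ)

inv′-map-suc : ∀ σ → inv′ (map suc σ) ≡ inv′ σ
inv′-map-suc [] = refl
inv′-map-suc (x ∷ σ) = cong₂ _+_ (specialFrom-map-suc x σ) (inv′-map-suc σ)

bump-map-suc : ∀ y σ cs → bump (suc y) (map suc σ) cs ≡ bump y σ cs
bump-map-suc y [] cs = refl
bump-map-suc y (z ∷ σ) [] = refl
bump-map-suc y (z ∷ σ) (c ∷ cs) =
  cong₂ (λ b ds → (b2n b + c) ∷ ds) (any-map (λ x → suc y <ᵇ x) suc (z ∷ σ)) (bump-map-suc y σ cs)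

counters-map-suc : ∀ σ → counters (map suc σ) ≡ counters σ
counters-map-suc [] = refl
counters-map-suc (y ∷ σ) = cong (0 ∷_)
  (trans (cong (bump (suc y) (map suc σ)) (counters-map-suc σ)) (bump-map-suc y σ (counters σ)))

rlm+nonMaxima : ∀ σ → rlm σ + nonMaxima σ ≡ length σ
rlm+nonMaxima [] = refl
rlm+nonMaxima (x ∷ σ) with all (λ y → y <ᵇ x) σ
... | true = cong suc (rlm+nonMaxima σ)
... | false = trans (ℕₚ.+-suc (rlm σ) (nonMaxima σ)) (cong suc (rlm+nonMaxima σ))

length-bump : ∀ y ys cs → length cs ≡ length ys → length (bump y ys cs) ≡ length ys
length-bump y [] [] e = refl
length-bump y (z ∷ ys) (c ∷ cs) e = cong suc (length-bump y ys cs (ℕₚ.suc-injective e))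

length-counters : ∀ ys → length (counters ys) ≡ length ys
length-counters [] = refl
length-counters (y ∷ ys) = cong suc (length-bump y ys (counters ys) (length-counters ys))

bump-suc : ∀ y ys cs → bump y ys (map suc cs) ≡ map suc (bump y ys cs)
bump-suc y [] cs = refl
bump-suc y (z ∷ ys) [] = refl
bump-suc y (z ∷ ys) (c ∷ cs) = cong₂ _∷_ (ℕₚ.+-suc _ c) (bump-suc y ys cs)

bump-zero : ∀ σ cs → length cs ≡ length σ → bump 0 (map suc σ) cs ≡ map suc cs
bump-zero [] [] e = refl
bump-zero (z ∷ σ) (c ∷ cs) e = cong (suc c ∷_) (bump-zero σ cs (ℕₚ.suc-injective e))

bump-insertAt : ∀ y p σ cs → length cs ≡ length σ →
  bump (suc y) (insertAt p 0 (map suc σ)) (insertCounter p cs) ≡ insertCounter p (bump (suc y) (map suc σ) cs)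
bump-insertAt y p [] [] e = refl
bump-insertAt y zero (z ∷ σ) (c ∷ cs) e =
  cong (b + c ∷_) (cong₂ _∷_ (ℕₚ.+-suc b c) (bump-suc (suc y) (map suc σ) cs))
  where b = b2n (any (λ x → suc y <ᵇ x) (map suc (z ∷ σ)))
bump-insertAt y (suc p) (z ∷ σ) (c ∷ cs) e = cong₂ (λ b ds → (b2n ((y <ᵇ z) ∨ b) + c) ∷ ds)
  (any-insertAt (λ x → suc y <ᵇ x) p (map suc σ) refl) (bump-insertAt y p σ cs (ℕₚ.suc-injective e))

counters-insertAt : ∀ p σ → counters (insertAt p 0 (map suc σ)) ≡ insertCounter p (counters (map suc σ))
counters-insertAt p [] = refl
counters-insertAt zero (y ∷ σ) =
  cong (0 ∷_) (bump-zero (y ∷ σ) (counters (map suc (y ∷ σ)))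
    (trans (length-counters (map suc (y ∷ σ))) (Listₚ.length-map suc (y ∷ σ))))
counters-insertAt (suc p) (y ∷ σ) = cong (0 ∷_)
  (trans (cong (bump (suc y) (insertAt p 0 (map suc σ))) (counters-insertAt p σ))
    (bump-insertAt y p σ (counters (map suc σ)) (trans (length-counters (map suc σ)) (Listₚ.length-map suc σ))))

-- Whether an earlier entry y forms a special inversion with a smallest value inserted at p.
flag : ℕ → ℕ → List ℕ → ℕ
flag p y [] = 0
flag zero y (z ∷ zs) = b2n (any (λ x → y <ᵇ x) (z ∷ zs))
flag (suc p) y (z ∷ zs) = flag p y zs

specialFrom-insertAt : ∀ y p σ → specialFrom (suc y) (insertAt p 0 (map suc σ)) ≡
  flag p (suc y) (map suc σ) + specialFrom (suc y) (map suc σ)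
specialFrom-insertAt y p [] = refl
specialFrom-insertAt y zero (z ∷ σ) = refl
specialFrom-insertAt y (suc p) (z ∷ σ) = trans
  (cong₂ (λ b n → b2n ((z <ᵇ y) ∧ b) + n)
    (any-insertAt (λ x → suc y <ᵇ x) p (map suc σ) refl) (specialFrom-insertAt y p σ))
  (exchange (b2n ((z <ᵇ y) ∧ any (λ x → suc y <ᵇ x) (map suc σ))) (flag p (suc y) (map suc σ)) _)
  where
  exchange : ∀ a b c → a + (b + c) ≡ b + (a + c)
  exchange = solve-∀ℕ

counterAt-bump : ∀ p y ys cs → length cs ≡ length ys → counterAt p (bump y ys cs) ≡ flag p y ys + counterAt p cs
counterAt-bump p y [] [] e = refl
counterAt-bump zero y (z ∷ ys) (c ∷ cs) e = refl
counterAt-bump (suc p) y (z ∷ ys) (c ∷ cs) e = counterAt-bump p y ys cs (ℕₚ.suc-injective e)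

specialFrom-zero : ∀ σ → specialFrom 0 σ ≡ 0
specialFrom-zero [] = refl
specialFrom-zero (y ∷ σ) = specialFrom-zero σ

-- A smallest value is neither the larger entry of an inversion nor a witness that one is special,
-- so the old special inversions persist and the additional ones are those counted by `counters`.
inv′-insertAt : ∀ p σ → inv′ (insertAt p 0 (map suc σ)) ≡ counterAt p (counters (map suc σ)) + inv′ (map suc σ)
inv′-insertAt p [] = refl
inv′-insertAt zero (y ∷ σ) = cong (_+ inv′ (map suc (y ∷ σ))) (specialFrom-zero (map suc (y ∷ σ)))
inv′-insertAt (suc p) (y ∷ σ) = begin
  specialFrom (suc y) (insertAt p 0 τ) + inv′ (insertAt p 0 τ)
    ≡⟨ cong₂ _+_ (specialFrom-insertAt y p σ) (inv′-insertAt p σ) ⟩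
  (flag p (suc y) τ + specialFrom (suc y) τ) + (counterAt p (counters τ) + inv′ τ)
    ≡⟨ exchange (flag p (suc y) τ) _ _ _ ⟩
  (flag p (suc y) τ + counterAt p (counters τ)) + (specialFrom (suc y) τ + inv′ τ)
    ≡⟨ cong (_+ (specialFrom (suc y) τ + inv′ τ)) (sym (counterAt-bump p (suc y) τ (counters τ) (length-counters τ))) ⟩
  counterAt p (bump (suc y) τ (counters τ)) + (specialFrom (suc y) τ + inv′ τ) ∎
  where
  open ≡-Reasoning
  τ = map suc σ
  exchange : ∀ a b c d → (a + b) + (c + d) ≡ (a + c) + (b + d)
  exchange = solve-∀ℕ

-- A smallest value is a right-to-left maximum only in the last place and never prevents another
-- entry from being one. So insertion before the end corresponds to E, at the end to Z.
nonMaxima-insertAt : ∀ p σ → p < length σ → nonMaxima (insertAt p 0 (map suc σ)) ≡ suc (nonMaxima (map suc σ))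
nonMaxima-insertAt zero (y ∷ σ) p<l = refl
nonMaxima-insertAt (suc p) (y ∷ σ) (s≤s p<l) = trans
  (cong₂ (λ b n → b2n (not b) + n) (all-insertAt (λ x → x <ᵇ suc y) p (map suc σ) refl) (nonMaxima-insertAt p σ p<l))
  (ℕₚ.+-suc _ (nonMaxima (map suc σ)))

nonMaxima-append : ∀ σ → nonMaxima (insertAt (length σ) 0 (map suc σ)) ≡ nonMaxima (map suc σ)
nonMaxima-append [] = refl
nonMaxima-append (y ∷ σ) = cong₂ (λ b n → b2n (not b) + n)
  (all-insertAt (λ x → x <ᵇ suc y) (length σ) (map suc σ) refl) (nonMaxima-append σ)

counterAt-length : ∀ cs → counterAt (length cs) cs ≡ 0
counterAt-length [] = refl
counterAt-length (c ∷ cs) = counterAt-length cs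

-- S₁ as a sum of words in E and Z

module _ (φ : ℕ → ℤ) where

  -- The coefficients of ∏_c 1 / (1 + q^c U).
  η : List ℕ → Series
  η [] j a = one φ j a
  η (c ∷ cs) zero a = φ a
  η (c ∷ cs) (suc j) a = η cs (suc j) a -ℤ η (c ∷ cs) j (a + c)

  η-zero : ∀ cs a → η cs 0 a ≡ φ a
  η-zero [] a = refl
  η-zero (c ∷ cs) a = refl

  -- Raising every counter by one replaces U by q U, which multiplies the coefficient of U^j by q^j.
  η-map-suc : ∀ cs j a → η (map suc cs) j a ≡ η cs j (a + j)
  η-map-suc [] zero a = cong φ (sym (ℕₚ.+-identityʳ a))
  η-map-suc [] (suc j) a = refl
  η-map-suc (c ∷ cs) zero a = cong φ (sym (ℕₚ.+-identityʳ a))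
  η-map-suc (c ∷ cs) (suc j) a = cong₂ _-ℤ_ (η-map-suc cs (suc j) a)
    (trans (η-map-suc (c ∷ cs) j (a + suc c)) (cong (η (c ∷ cs) j) (exchange a c j)))
    where
    exchange : ∀ a c j → (a + suc c) + j ≡ (a + suc j) + c
    exchange = solve-∀ℕ

  -- The q-Leibniz rule for E on a product, differentiating one factor at a time:
  -- E (1 / (1 + q^c U)) = q^c / ((1 + q^c U) (1 + q^(c+1) U)).
  η-insertCounter : ∀ cs j a →
    Σ< (length cs) (λ p → η (insertCounter p cs) j (a + counterAt p cs)) ≡ E (η cs) j a
  η-insertCounter [] j a = sym (cong -ℤ_ (brk-zero (suc j) a))
  η-insertCounter (c ∷ cs) zero a = begin
    φ (a + c) +ℤ Σ< (length cs) (λ p → φ (a + counterAt p cs))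
      ≡⟨ cong (φ (a + c) +ℤ_) (Σ<-cong (length cs) (λ p → sym (η-zero (insertCounter p cs) (a + counterAt p cs)))) ⟩
    φ (a + c) +ℤ Σ< (length cs) (λ p → η (insertCounter p cs) 0 (a + counterAt p cs))
      ≡⟨ cong (φ (a + c) +ℤ_) (η-insertCounter cs zero a) ⟩
    φ (a + c) +ℤ E (η cs) 0 a
      ≡⟨ regroup (φ (a + c)) (η cs 1 a) ⟩
    E (η (c ∷ cs)) 0 a ∎
    where
    open ≡-Reasoning
    regroup : ∀ x y → x +ℤ (-ℤ (y +ℤ + 0)) ≡ -ℤ ((y -ℤ x) +ℤ + 0)
    regroup = solve-∀
  η-insertCounter (c ∷ cs) (suc j) a = begin
    (h₁ -ℤ h₂) +ℤ Σ< (length cs) (λ p → η (insertCounter p cs) (suc j) (a + w p) -ℤ η (c ∷ insertCounter p cs) j ((a + w p) + c))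
      ≡⟨ cong ((h₁ -ℤ h₂) +ℤ_) (Σ<-minus (length cs) (λ p → η (insertCounter p cs) (suc j) (a + w p)) _) ⟩
    (h₁ -ℤ h₂) +ℤ (Σ< (length cs) (λ p → η (insertCounter p cs) (suc j) (a + w p)) -ℤ Σ< (length cs) (λ p → η (c ∷ insertCounter p cs) j ((a + w p) + c)))
      ≡⟨ cong₂ (λ y z → (h₁ -ℤ h₂) +ℤ (y -ℤ z)) (η-insertCounter cs (suc j) a)
          (Σ<-cong (length cs) (λ p → cong (η (c ∷ insertCounter p cs) j) (exchange a (w p) c))) ⟩
    (h₁ -ℤ h₂) +ℤ (E (η cs) (suc j) a -ℤ s)
      ≡⟨ regroup h₁ h₂ (E (η cs) (suc j) a) s ⟩
    (h₁ -ℤ (h₂ +ℤ s)) +ℤ E (η cs) (suc j) a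
      -- In `h₁` all counters are raised by one, and `h₂` + `s` is the left-hand side of the
      -- identity for the whole list `c ∷ cs` at the lower index j.
      ≡⟨ cong₂ (λ y z → (y -ℤ z) +ℤ E (η cs) (suc j) a) (η-map-suc (c ∷ cs) (suc j) (a + c)) (η-insertCounter (c ∷ cs) j (a + c)) ⟩
    (f (a + c + suc j) -ℤ (-ℤ brk (suc j) f (a + c))) +ℤ (-ℤ r)
      ≡⟨ collect (f (a + c + suc j)) (brk (suc j) f (a + c)) r ⟩
    -ℤ (r -ℤ (brk (suc j) f (a + c) +ℤ f (a + c + suc j)))
      ≡⟨ cong (λ z → -ℤ (r -ℤ z)) (sym (brk-last (suc j) f (a + c))) ⟩
    -ℤ (r -ℤ brk (suc (suc j)) f (a + c))
      ≡⟨ cong (λ z → -ℤ (r -ℤ z)) (sym (brk-shift (suc (suc j)) f c a)) ⟩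
    -ℤ (r -ℤ brk (suc (suc j)) (λ b → f (b + c)) a)
      ≡⟨ cong -ℤ_ (sym (brk-minus (suc (suc j)) (η cs (suc (suc j))) (λ b → f (b + c)) a)) ⟩
    E (η (c ∷ cs)) (suc j) a ∎
    where
    open ≡-Reasoning
    f : ℕ → ℤ
    f = η (c ∷ cs) (suc j)
    w : ℕ → ℕ
    w i = counterAt i cs
    r = brk (suc (suc j)) (η cs (suc (suc j))) a
    h₁ = η (map suc (c ∷ cs)) (suc j) (a + c)
    h₂ = η (c ∷ map suc (c ∷ cs)) j (a + c + c)
    s = Σ< (length cs) (λ p → η (c ∷ insertCounter p cs) j ((a + c) + w p))
    exchange : ∀ a w c → (a + w) + c ≡ (a + c) + w
    exchange = solve-∀ℕ
    regroup : ∀ x y z w → (x -ℤ y) +ℤ (z -ℤ w) ≡ (x -ℤ (y +ℤ w)) +ℤ z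
    regroup = solve-∀
    collect : ∀ x y z → (x -ℤ (-ℤ y)) +ℤ (-ℤ z) ≡ -ℤ (z -ℤ (y +ℤ x))
    collect = solve-∀

  -- Multiplication by 1 + q^c U turns η (c ∷ cs) into η cs and commutes with Z.
  Z-η-∷ : ∀ c cs j a → Z (η cs) (suc j) a ≡ Z (η (c ∷ cs)) (suc j) a +ℤ Z (η (c ∷ cs)) j (a + c)
  Z-η-∷ c cs zero a = trans (cong (λ z → η cs 1 a -ℤ z) (η-zero cs a)) (expand (η cs 1 a) (φ a) (φ (a + c)))
    where
    expand : ∀ x y z → x -ℤ y ≡ ((x -ℤ z) -ℤ y) +ℤ z
    expand = solve-∀
  Z-η-∷ c cs (suc j) a = trans (cong (λ z → η cs (suc (suc j)) a -ℤ z) (Z-η-∷ c cs j a))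
    (expand (η cs (suc (suc j)) a) (Z (η (c ∷ cs)) (suc j) a) (Z (η (c ∷ cs)) j (a + c)) (η (c ∷ cs) (suc j) (a + c)))
    where
    expand : ∀ x y z w → x -ℤ (y +ℤ z) ≡ ((x -ℤ w) -ℤ y) +ℤ (w -ℤ z)
    expand = solve-∀

  -- The new counter 0 contributes the factor 1 / (1 + U). As `η` recurses from the front, this
  -- factor has to be carried through the list.
  η-append : ∀ cs j a → η (insertCounter (length cs) cs) j a ≡ Z (η cs) j a
  η-append cs zero a = trans (η-zero (insertCounter (length cs) cs) a) (sym (η-zero cs a))
  η-append [] (suc j) a = cong (λ z → + 0 -ℤ z)
    (trans (cong (η [ 0 ] j) (ℕₚ.+-identityʳ a)) (η-append [] j a))
  η-append (c ∷ cs) (suc j) a = trans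
    (cong₂ _-ℤ_ (trans (η-append cs (suc j) a) (Z-η-∷ c cs j a)) (η-append (c ∷ cs) j (a + c)))
    (cancel (Z (η (c ∷ cs)) (suc j) a) (Z (η (c ∷ cs)) j (a + c)))
    where
    cancel : ∀ x y → (x +ℤ y) -ℤ y ≡ x
    cancel = solve-∀

  permTerm : ℕ → ℕ → ℕ → List ℕ → ℤ
  permTerm m j a σ = when (nonMaxima σ ≡ᵇ m) (η (counters σ) j (a + inv′ σ))

  Σ-insertMin : ∀ m j a σ → Σ∈ (insertMin σ) (permTerm m j a) ≡
    when (suc (nonMaxima σ) ≡ᵇ m) (E (η (counters σ)) j (a + inv′ σ)) +ℤ
    when (nonMaxima σ ≡ᵇ m) (Z (η (counters σ)) j (a + inv′ σ))
  Σ-insertMin m j a σ = begin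
    Σ∈ (insertMin σ) (permTerm m j a)
      ≡⟨ Σ-insertAll 0 (map suc σ) (permTerm m j a) ⟩
    Σ< (suc (length (map suc σ))) (λ p → permTerm m j a (insertAt p 0 (map suc σ)))
      ≡⟨ cong (λ l → Σ< (suc l) (λ p → permTerm m j a (insertAt p 0 (map suc σ)))) (Listₚ.length-map suc σ) ⟩
    Σ< (suc (length σ)) (λ p → permTerm m j a (insertAt p 0 (map suc σ)))
      ≡⟨ Σ<-last (length σ) (λ p → permTerm m j a (insertAt p 0 (map suc σ))) ⟩
    Σ< (length σ) (λ p → permTerm m j a (insertAt p 0 (map suc σ))) +ℤ permTerm m j a (insertAt (length σ) 0 (map suc σ))
      ≡⟨ cong₂ _+ℤ_ inner outer ⟩
    when (suc (nonMaxima σ) ≡ᵇ m) (E (η cs) j (a + inv′ σ)) +ℤ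
    when (nonMaxima σ ≡ᵇ m) (Z (η cs) j (a + inv′ σ)) ∎
    where
    open ≡-Reasoning
    cs = counters σ
    cs-length : length cs ≡ length σ
    cs-length = length-counters σ
    exchange : ∀ a w v → a + (w + v) ≡ (a + v) + w
    exchange = solve-∀ℕ
    weight : ∀ p → η (counters (insertAt p 0 (map suc σ))) j (a + inv′ (insertAt p 0 (map suc σ))) ≡
      η (insertCounter p cs) j ((a + inv′ σ) + counterAt p cs)
    weight p = cong₂ (λ ds b → η ds j b)
      (trans (counters-insertAt p σ) (cong (insertCounter p) (counters-map-suc σ)))
      (trans (cong (λ b → a + b) (trans (inv′-insertAt p σ)
          (cong₂ (λ ds v → counterAt p ds + v) (counters-map-suc σ) (inv′-map-suc σ))))
        (exchange a (counterAt p cs) (inv′ σ)))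
    b = suc (nonMaxima σ) ≡ᵇ m
    Σ<-when : ∀ b n f → Σ< n (λ p → when b (f p)) ≡ when b (Σ< n f)
    Σ<-when true n f = refl
    Σ<-when false n f = Σ<-zero n
    inner : Σ< (length σ) (λ p → permTerm m j a (insertAt p 0 (map suc σ))) ≡ when b (E (η cs) j (a + inv′ σ))
    inner = begin
      Σ< (length σ) (λ p → permTerm m j a (insertAt p 0 (map suc σ)))
        ≡⟨ Σ<-cong< (length σ) (λ p p<l → cong₂ (λ k z → when (k ≡ᵇ m) z)
            (trans (nonMaxima-insertAt p σ p<l) (cong suc (nonMaxima-map-suc σ))) (weight p)) ⟩
      Σ< (length σ) (λ p → when b (η (insertCounter p cs) j ((a + inv′ σ) + counterAt p cs)))
        ≡⟨ Σ<-when b (length σ) _ ⟩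
      when b (Σ< (length σ) (λ p → η (insertCounter p cs) j ((a + inv′ σ) + counterAt p cs)))
        ≡⟨ cong (λ l → when b (Σ< l (λ p → η (insertCounter p cs) j ((a + inv′ σ) + counterAt p cs)))) (sym cs-length) ⟩
      when b (Σ< (length cs) (λ p → η (insertCounter p cs) j ((a + inv′ σ) + counterAt p cs)))
        ≡⟨ cong (when b) (η-insertCounter cs j (a + inv′ σ)) ⟩
      when b (E (η cs) j (a + inv′ σ)) ∎
    outer : permTerm m j a (insertAt (length σ) 0 (map suc σ)) ≡ when (nonMaxima σ ≡ᵇ m) (Z (η cs) j (a + inv′ σ))
    outer = cong₂ (λ k z → when (k ≡ᵇ m) z) (trans (nonMaxima-append σ) (nonMaxima-map-suc σ))
      (begin
        η (counters (insertAt (length σ) 0 (map suc σ))) j (a + inv′ (insertAt (length σ) 0 (map suc σ)))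
          ≡⟨ weight (length σ) ⟩
        η (insertCounter (length σ) cs) j ((a + inv′ σ) + counterAt (length σ) cs)
          ≡⟨ cong (λ l → η (insertCounter l cs) j ((a + inv′ σ) + counterAt l cs)) (sym cs-length) ⟩
        η (insertCounter (length cs) cs) j ((a + inv′ σ) + counterAt (length cs) cs)
          ≡⟨ cong (η (insertCounter (length cs) cs) j) (trans (cong (λ w → (a + inv′ σ) + w) (counterAt-length cs)) (ℕₚ.+-identityʳ _)) ⟩
        η (insertCounter (length cs) cs) j (a + inv′ σ)
          ≡⟨ η-append cs j (a + inv′ σ) ⟩
        Z (η cs) j (a + inv′ σ) ∎)

  permSeries : ℕ → ℕ → Series
  permSeries n m = weighted (minPerms n) (λ σ → nonMaxima σ ≡ᵇ m) inv′ (η ∘ counters)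

  permSeries-suc : ∀ n m j a → permSeries (suc n) m j a ≡
    weighted (minPerms n) (λ σ → suc (nonMaxima σ) ≡ᵇ m) inv′ (E ∘ η ∘ counters) j a +ℤ Z (permSeries n m) j a
  permSeries-suc n m j a = begin
    Σ∈ (minPerms (suc n)) (permTerm m j a)
      ≡⟨ Σ∈-concatMap insertMin (minPerms n) (permTerm m j a) ⟩
    Σ∈ (minPerms n) (λ σ → Σ∈ (insertMin σ) (permTerm m j a))
      ≡⟨ Σ∈-cong (minPerms n) (Σ-insertMin m j a) ⟩
    Σ∈ (minPerms n) (λ σ → when (suc (nonMaxima σ) ≡ᵇ m) (E (η (counters σ)) j (a + inv′ σ)) +ℤ
        when (nonMaxima σ ≡ᵇ m) (Z (η (counters σ)) j (a + inv′ σ)))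
      ≡⟨ Σ∈-+ (minPerms n) _ _ ⟩
    e j a +ℤ weighted (minPerms n) (λ σ → nonMaxima σ ≡ᵇ m) inv′ (Z ∘ η ∘ counters) j a
      ≡⟨ cong (e j a +ℤ_) (weighted-Z (minPerms n) (λ σ → nonMaxima σ ≡ᵇ m) inv′ (η ∘ counters) j a) ⟩
    e j a +ℤ Z (permSeries n m) j a ∎
    where
    open ≡-Reasoning
    e = weighted (minPerms n) (λ σ → suc (nonMaxima σ) ≡ᵇ m) inv′ (E ∘ η ∘ counters)

  permSeries≈words : ∀ n m → permSeries n m ≈ words E Z (one φ) n m
  permSeries≈words zero zero j a = trans (ℤₚ.+-identityʳ _) (cong (one φ j) (ℕₚ.+-identityʳ a))
  permSeries≈words zero (suc m) j a = refl
  permSeries≈words (suc n) zero j a = trans (permSeries-suc n zero j a)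
    (trans (cong (_+ℤ Z (permSeries n zero) j a) (Σ∈-zero (minPerms n)))
      (trans (ℤₚ.+-identityˡ _) (Z-cong (permSeries≈words n zero) j a)))
  permSeries≈words (suc n) (suc m) j a = trans (permSeries-suc n (suc m) j a)
    (cong₂ _+ℤ_
      (trans (weighted-E (minPerms n) (λ σ → nonMaxima σ ≡ᵇ m) inv′ (η ∘ counters) j a)
        (cong -ℤ_ (D-cong (permSeries≈words n m) j a)))
      (Z-cong (permSeries≈words n (suc m)) j a))

-- Used as φ, it makes the value at a = 0 the coefficient of q^d.
δ : ℕ → ℕ → ℤ
δ d a = + b2n (a ≡ᵇ d)

S₁≡words : ∀ m k d → S₁ (m + k) k d ≡ words E Z (one (δ d)) (m + k) m 0 0
S₁≡words m k d = begin
  S₁ (m + k) k d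
    ≡⟨ Σ∈-indicator (λ σ → (rlm σ ≡ᵇ k) ∧ (inv′ σ ≡ᵇ d)) (perms (m + k)) ⟩
  Σ∈ (perms (m + k)) (λ σ → + b2n ((rlm σ ≡ᵇ k) ∧ (inv′ σ ≡ᵇ d)))
    ≡⟨ Σ-perms (m + k) _ ⟩
  Σ∈ (minPerms (m + k)) (λ σ → + b2n ((rlm (map suc σ) ≡ᵇ k) ∧ (inv′ (map suc σ) ≡ᵇ d)))
    ≡⟨ Σ∈-cong-All (All-map (λ {σ} e → term σ e) (minPerms-length (m + k))) ⟩
  permSeries (δ d) (m + k) m 0 0
    ≡⟨ permSeries≈words (δ d) (m + k) m 0 0 ⟩
  words E Z (one (δ d)) (m + k) m 0 0 ∎
  where
  open ≡-Reasoning
  term : ∀ σ → length σ ≡ m + k →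
    + b2n ((rlm (map suc σ) ≡ᵇ k) ∧ (inv′ (map suc σ) ≡ᵇ d)) ≡ permTerm (δ d) m 0 0 σ
  term σ e = begin
    + b2n ((rlm (map suc σ) ≡ᵇ k) ∧ (inv′ (map suc σ) ≡ᵇ d))
      ≡⟨ cong₂ (λ x y → + b2n ((x ≡ᵇ k) ∧ (y ≡ᵇ d))) (rlm-map-suc σ) (inv′-map-suc σ) ⟩
    + b2n ((rlm σ ≡ᵇ k) ∧ (inv′ σ ≡ᵇ d))
      ≡⟨ b2n-∧ (rlm σ ≡ᵇ k) _ ⟩
    when (rlm σ ≡ᵇ k) (δ d (inv′ σ))
      ≡⟨ cong₂ when (≡ᵇ-complement (rlm σ) k (trans (rlm+nonMaxima σ) (trans e (ℕₚ.+-comm m k))))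
          (sym (η-zero (δ d) (counters σ) (inv′ σ))) ⟩
    permTerm (δ d) m 0 0 σ ∎

-- S₂ as a sum of words in X and Y

pick : {A : Set} → List A → List (A × List A)
pick [] = []
pick (x ∷ xs) = (x , xs) ∷ map (λ (y , ys) → y , x ∷ ys) (pick xs)

-- Chooses a block to extend. The exponents before the chosen one go up by one, because they belong
-- to blocks with a larger last element, which the new arc covers.
pickBump : List ℕ → List (ℕ × List ℕ)
pickBump [] = []
pickBump (x ∷ xs) = (x , xs) ∷ map (λ (y , ys) → y , suc x ∷ ys) (pickBump xs)

module _ (φ : ℕ → ℤ) where

  -- The coefficients of ∏_x (1 + q^x U).
  esp : List ℕ → Series
  esp [] j a = one φ j a
  esp (x ∷ xs) zero a = φ a
  esp (x ∷ xs) (suc j) a = esp xs (suc j) a +ℤ esp xs j (a + x)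

  esp-zero : ∀ xs a → esp xs 0 a ≡ φ a
  esp-zero [] a = refl
  esp-zero (x ∷ xs) a = refl

  esp-0∷ : ∀ xs → esp (0 ∷ xs) ≈ Y (esp xs)
  esp-0∷ xs zero a = sym (esp-zero xs a)
  esp-0∷ xs (suc j) a = cong (λ b → esp xs (suc j) a +ℤ esp xs j b) (ℕₚ.+-identityʳ a)

  -- The q-Leibniz rule for D on a product, differentiating one factor at a time.
  esp-pickBump : ∀ xs j a → Σ∈ (pickBump xs) (λ (w , ys) → esp ys j (a + w)) ≡ D (esp xs) j a
  esp-pickBump [] j a = sym (brk-zero (suc j) a)
  esp-pickBump (x ∷ xs) zero a = begin
    esp xs 0 (a + x) +ℤ Σ∈ (map (λ (w , ys) → w , suc x ∷ ys) (pickBump xs)) (λ (w , ys) → esp ys 0 (a + w))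
      ≡⟨ cong (esp xs 0 (a + x) +ℤ_) (Σ∈-map _ (pickBump xs) _) ⟩
    esp xs 0 (a + x) +ℤ Σ∈ (pickBump xs) (λ (w , ys) → φ (a + w))
      ≡⟨ cong (esp xs 0 (a + x) +ℤ_) (Σ∈-cong (pickBump xs) (λ (w , ys) → sym (esp-zero ys (a + w)))) ⟩
    esp xs 0 (a + x) +ℤ Σ∈ (pickBump xs) (λ (w , ys) → esp ys 0 (a + w))
      ≡⟨ cong (esp xs 0 (a + x) +ℤ_) (esp-pickBump xs zero a) ⟩
    esp xs 0 (a + x) +ℤ (esp xs 1 a +ℤ + 0)
      ≡⟨ regroup (esp xs 0 (a + x)) (esp xs 1 a) ⟩
    D (esp (x ∷ xs)) zero a ∎
    where
    open ≡-Reasoning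
    regroup : ∀ x y → x +ℤ (y +ℤ + 0) ≡ (y +ℤ x) +ℤ + 0
    regroup = solve-∀
  esp-pickBump (x ∷ xs) (suc j) a = begin
    f (a + x) +ℤ Σ∈ (map (λ (w , ys) → w , suc x ∷ ys) (pickBump xs)) (λ (w , ys) → esp ys (suc j) (a + w))
      ≡⟨ cong (f (a + x) +ℤ_) (Σ∈-map _ (pickBump xs) _) ⟩
    f (a + x) +ℤ Σ∈ (pickBump xs) (λ (w , ys) → esp ys (suc j) (a + w) +ℤ esp ys j (a + w + suc x))
      ≡⟨ cong (f (a + x) +ℤ_) (Σ∈-cong (pickBump xs)
          (λ (w , ys) → cong (λ b → esp ys (suc j) (a + w) +ℤ esp ys j b) (exchange a w x))) ⟩
    f (a + x) +ℤ Σ∈ (pickBump xs) (λ (w , ys) → esp ys (suc j) (a + w) +ℤ esp ys j (suc (a + x) + w))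
      ≡⟨ cong (f (a + x) +ℤ_) (Σ∈-+ (pickBump xs) (λ (w , ys) → esp ys (suc j) (a + w)) (λ (w , ys) → esp ys j (suc (a + x) + w))) ⟩
    f (a + x) +ℤ (Σ∈ (pickBump xs) (λ (w , ys) → esp ys (suc j) (a + w)) +ℤ
      Σ∈ (pickBump xs) (λ (w , ys) → esp ys j (suc (a + x) + w)))
      ≡⟨ cong₂ (λ y z → f (a + x) +ℤ (y +ℤ z)) (esp-pickBump xs (suc j) a) (esp-pickBump xs j (suc (a + x))) ⟩
    f (a + x) +ℤ (D (esp xs) (suc j) a +ℤ brk (suc j) f (suc (a + x)))
      -- The term in which x itself is picked completes q [j+1] to [j+2] = 1 + q [j+1].
      ≡⟨ +-left-comm (f (a + x)) (D (esp xs) (suc j) a) (brk (suc j) f (suc (a + x))) ⟩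
    D (esp xs) (suc j) a +ℤ brk (suc (suc j)) f (a + x)
      ≡⟨ cong (D (esp xs) (suc j) a +ℤ_) (sym (brk-shift (suc (suc j)) f x a)) ⟩
    D (esp xs) (suc j) a +ℤ brk (suc (suc j)) (λ b → f (b + x)) a
      ≡⟨ brk-+ (suc (suc j)) (esp xs (suc (suc j))) (λ b → f (b + x)) a ⟨
    D (esp (x ∷ xs)) (suc j) a ∎
    where
    open ≡-Reasoning
    f : ℕ → ℤ
    f = esp xs (suc j)
    exchange : ∀ a w x → a + w + suc x ≡ suc (a + x) + w
    exchange = solve-∀ℕ

-- Crossings in lists of arcs

+-left-commℕ : ∀ a b c → a + (b + c) ≡ b + (a + c)
+-left-commℕ = solve-∀ℕ

count : {A : Set} → (A → Bool) → List A → ℕ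
count p xs = length (filterᵇ p xs)

module _ {A : Set} (p : A → Bool) where

  count-∷ : ∀ x xs → count p (x ∷ xs) ≡ b2n (p x) + count p xs
  count-∷ x xs with p x
  ... | true = refl
  ... | false = refl

  count-++ : ∀ xs ys → count p (xs ++ ys) ≡ count p xs + count p ys
  count-++ [] ys = refl
  count-++ (x ∷ xs) ys with p x
  ... | true = cong suc (count-++ xs ys)
  ... | false = count-++ xs ys

  count-map : ∀ {B : Set} (f : B → A) xs → count p (map f xs) ≡ count (p ∘ f) xs
  count-map f [] = refl
  count-map f (x ∷ xs) with p (f x)
  ... | true = cong suc (count-map f xs)
  ... | false = count-map f xs

  count-none : ∀ {xs} → All (λ x → p x ≡ false) xs → count p xs ≡ 0
  count-none [] = refl
  count-none {x ∷ xs} (h ∷ hs) = trans (count-∷ x xs) (cong₂ (λ b n → b2n b + n) h (count-none hs))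

  count-cong : ∀ {r : A → Bool} {xs} → All (λ x → p x ≡ r x) xs → count p xs ≡ length (filterᵇ r xs)
  count-cong [] = refl
  count-cong {r} {x ∷ xs} (h ∷ hs) with p x | r x | h
  ... | true | true | _ = cong suc (count-cong hs)
  ... | false | false | _ = count-cong hs

  count-↭ : ∀ {xs ys} → xs ↭ ys → count p xs ≡ count p ys
  count-↭ refl = refl
  count-↭ (prep {xs} {ys} x h) = trans (count-∷ x xs)
    (trans (cong (λ n → b2n (p x) + n) (count-↭ h)) (sym (count-∷ x ys)))
  count-↭ (swap {xs} {ys} x y h) = begin
    count p (x ∷ y ∷ xs)                    ≡⟨ trans (count-∷ x (y ∷ xs)) (cong (λ n → b2n (p x) + n) (count-∷ y xs)) ⟩
    b2n (p x) + (b2n (p y) + count p xs)    ≡⟨ cong (λ n → b2n (p x) + (b2n (p y) + n)) (count-↭ h) ⟩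
    b2n (p x) + (b2n (p y) + count p ys)    ≡⟨ +-left-commℕ (b2n (p x)) (b2n (p y)) (count p ys) ⟩
    b2n (p y) + (b2n (p x) + count p ys)    ≡⟨ trans (count-∷ y (x ∷ ys)) (cong (λ n → b2n (p y) + n) (count-∷ x ys)) ⟨
    count p (y ∷ x ∷ ys) ∎
    where open ≡-Reasoning
  count-↭ (↭-step h k) = trans (count-↭ h) (count-↭ k)

Arc : Set
Arc = ℕ × ℕ

crossPairs : List Arc → List Arc → ℕ
crossPairs As Bs = count crosses (cartesianProduct As Bs)

crossings : List Arc → ℕ
crossings As = crossPairs As As

covering : ℕ → Arc → Bool
covering l (a , c) = (a <ᵇ l) ∧ (l <ᵇ c)

covers : List Arc → ℕ → ℕ
covers As l = count (covering l) As

crossPairs-∷ˡ : ∀ α As Bs → crossPairs (α ∷ As) Bs ≡ count (λ β → crosses (α , β)) Bs + crossPairs As Bs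
crossPairs-∷ˡ α As Bs = trans (count-++ crosses (map (α ,_) Bs) (cartesianProduct As Bs))
  (cong (_+ crossPairs As Bs) (count-map crosses (α ,_) Bs))

crossPairs-∷ʳ : ∀ β As Bs → crossPairs As (β ∷ Bs) ≡ count (λ α → crosses (α , β)) As + crossPairs As Bs
crossPairs-∷ʳ β [] Bs = refl
crossPairs-∷ʳ β (α ∷ As) Bs = begin
  crossPairs (α ∷ As) (β ∷ Bs)
    ≡⟨ crossPairs-∷ˡ α As (β ∷ Bs) ⟩
  count (λ β → crosses (α , β)) (β ∷ Bs) + crossPairs As (β ∷ Bs)
    ≡⟨ cong₂ _+_ (count-∷ (λ β → crosses (α , β)) β Bs) (crossPairs-∷ʳ β As Bs) ⟩
  (x + u) + (v + w)
    ≡⟨ exchange x u v w ⟩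
  (x + v) + (u + w)
    ≡⟨ cong₂ _+_ (count-∷ (λ α → crosses (α , β)) α As) (crossPairs-∷ˡ α As Bs) ⟨
  count (λ α → crosses (α , β)) (α ∷ As) + crossPairs (α ∷ As) Bs ∎
  where
  open ≡-Reasoning
  x = b2n (crosses (α , β))
  u = count (λ β → crosses (α , β)) Bs
  v = count (λ α → crosses (α , β)) As
  w = crossPairs As Bs
  exchange : ∀ a b c d → (a + b) + (c + d) ≡ (a + c) + (b + d)
  exchange = solve-∀ℕ

crossPairs-↭ : ∀ {As As′} Bs → As ↭ As′ → crossPairs As Bs ≡ crossPairs As′ Bs
crossPairs-↭ {As} {As′} [] h = trans (none As) (sym (none As′))
  where
  none : ∀ As → crossPairs As [] ≡ 0
  none [] = refl
  none (α ∷ As) = trans (crossPairs-∷ˡ α As []) (none As)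
crossPairs-↭ {As} {As′} (β ∷ Bs) h = trans (crossPairs-∷ʳ β As Bs)
  (trans (cong₂ _+_ (count-↭ (λ α → crosses (α , β)) h) (crossPairs-↭ Bs h)) (sym (crossPairs-∷ʳ β As′ Bs)))

crossings-↭ : ∀ {As As′} → As ↭ As′ → crossings As ≡ crossings As′
crossings-↭ {As} {As′} h = trans (crossPairs-↭ As h) (right As′)
  where
  right : ∀ Cs → crossPairs Cs As ≡ crossPairs Cs As′
  right [] = refl
  right (γ ∷ Cs) = trans (crossPairs-∷ˡ γ Cs As)
    (trans (cong₂ _+_ (count-↭ (λ β → crosses (γ , β)) h) (right Cs)) (sym (crossPairs-∷ˡ γ Cs As′)))

<ᵇ-true : ∀ {m n} → m < n → (m <ᵇ n) ≡ true
<ᵇ-true {zero} (s≤s h) = refl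
<ᵇ-true {suc m} (s≤s h) = <ᵇ-true h

<ᵇ-false : ∀ {m n} → n ≤ m → (m <ᵇ n) ≡ false
<ᵇ-false {m} {zero} z≤n = refl
<ᵇ-false (s≤s h) = <ᵇ-false h

∧-falseʳ : ∀ b {c} → c ≡ false → (b ∧ c) ≡ false
∧-falseʳ true e = e
∧-falseʳ false e = refl

-- No other arc ends at x or later, so the new arc can only be the second one of a crossing, and
-- (a,c) crosses it exactly if a < l < c.
crossings-∷ : ∀ l x {As} → All (λ α → proj₂ α < x) As → crossings ((l , x) ∷ As) ≡ covers As l + crossings As
crossings-∷ l x {As} h = begin
  crossings ((l , x) ∷ As)
    ≡⟨ crossPairs-∷ˡ (l , x) As ((l , x) ∷ As) ⟩
  count (λ β → crosses ((l , x) , β)) ((l , x) ∷ As) + crossPairs As ((l , x) ∷ As)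
    ≡⟨ cong₂ _+_ (count-none (λ β → crosses ((l , x) , β)) {(l , x) ∷ As}
        (cong (_∧ ((l <ᵇ x) ∧ (x <ᵇ x))) (<ᵇ-false {l} ℕₚ.≤-refl) ∷
          All-map (λ {(a , c)} c<x → ∧-falseʳ (l <ᵇ a) (∧-falseʳ (a <ᵇ x) (<ᵇ-false (ℕₚ.<⇒≤ c<x)))) h))
        (crossPairs-∷ʳ (l , x) As As) ⟩
  count (λ α → crosses (α , (l , x))) As + crossings As
    ≡⟨ cong (_+ crossings As) (count-cong (λ α → crosses (α , (l , x))) (All-map (λ {(a , c)} c<x →
        cong ((a <ᵇ l) ∧_) (trans (cong ((l <ᵇ c) ∧_) (<ᵇ-true c<x)) (∧-true (l <ᵇ c)))) h)) ⟩
  covers As l + crossings As ∎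
  where
  open ≡-Reasoning
  ∧-true : ∀ b → (b ∧ true) ≡ b
  ∧-true true = refl
  ∧-true false = refl

-- A set partition of {1,…,n} is reduced to the last elements of its blocks and its arcs.

State : Set
State = List ℕ × List Arc

grow : ℕ → State → List State
grow x (ls , As) = (x ∷ ls , As) ∷ map (λ (l , rest) → x ∷ rest , (l , x) ∷ As) (pick ls)

states : ℕ → List State
states zero = [ ([] , []) ]
states (suc n) = concatMap (grow (suc n)) (states n)

-- `addEach` leaves an extended block in its place, whereas `grow` moves it to the front; the two
-- enumerations agree on functions that ignore the order of blocks and arcs.
Invariant : (State → ℤ) → Set
Invariant g = ∀ {ls ls′ As As′} → ls ↭ ls′ → As ↭ As′ → g (ls , As) ≡ g (ls′ , As′)

Σ-pick-∷ : ∀ {A : Set} x (xs : List A) (h : A × List A → ℤ) →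
  Σ∈ (pick (x ∷ xs)) h ≡ h (x , xs) +ℤ Σ∈ (pick xs) (λ (y , ys) → h (y , x ∷ ys))
Σ-pick-∷ x xs h = cong (h (x , xs) +ℤ_) (Σ∈-map _ (pick xs) h)

Σ-pick-↭ : ∀ {A : Set} {xs ys : List A} → xs ↭ ys → (h : A × List A → ℤ) →
  (∀ x {zs zs′} → zs ↭ zs′ → h (x , zs) ≡ h (x , zs′)) → Σ∈ (pick xs) h ≡ Σ∈ (pick ys) h
Σ-pick-↭ refl h inv = refl
Σ-pick-↭ (prep {xs} {ys} x p) h inv = trans (Σ-pick-∷ x xs h)
  (trans (cong₂ _+ℤ_ (inv x p) (Σ-pick-↭ p (λ (y , zs) → h (y , x ∷ zs)) (λ y q → inv y (prep x q))))
    (sym (Σ-pick-∷ x ys h)))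
Σ-pick-↭ (swap {xs} {ys} x y p) h inv = begin
  Σ∈ (pick (x ∷ y ∷ xs)) h
    ≡⟨ expand x y xs ⟩
  h (x , y ∷ xs) +ℤ (h (y , x ∷ xs) +ℤ Σ∈ (pick xs) (λ (z , zs) → h (z , x ∷ y ∷ zs)))
    ≡⟨ cong₂ _+ℤ_ (inv x (prep y p)) (cong₂ _+ℤ_ (inv y (prep x p))
        (trans (Σ-pick-↭ p (λ (z , zs) → h (z , x ∷ y ∷ zs)) (λ z q → inv z (prep x (prep y q))))
          (Σ∈-cong (pick ys) (λ (z , zs) → inv z (swap x y refl))))) ⟩
  h (x , y ∷ ys) +ℤ (h (y , x ∷ ys) +ℤ Σ∈ (pick ys) (λ (z , zs) → h (z , y ∷ x ∷ zs)))
    ≡⟨ +-left-comm (h (x , y ∷ ys)) (h (y , x ∷ ys)) _ ⟩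
  h (y , x ∷ ys) +ℤ (h (x , y ∷ ys) +ℤ Σ∈ (pick ys) (λ (z , zs) → h (z , y ∷ x ∷ zs)))
    ≡⟨ expand y x ys ⟨
  Σ∈ (pick (y ∷ x ∷ ys)) h ∎
  where
  open ≡-Reasoning
  expand : ∀ x y xs → Σ∈ (pick (x ∷ y ∷ xs)) h ≡
    h (x , y ∷ xs) +ℤ (h (y , x ∷ xs) +ℤ Σ∈ (pick xs) (λ (z , zs) → h (z , x ∷ y ∷ zs)))
  expand x y xs = trans (Σ-pick-∷ x (y ∷ xs) h)
    (cong (h (x , y ∷ xs) +ℤ_) (Σ-pick-∷ y xs (λ (z , zs) → h (z , x ∷ zs))))
Σ-pick-↭ (↭-step p r) h inv = trans (Σ-pick-↭ p h inv) (Σ-pick-↭ r h inv)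

Σ-grow : ∀ x ls As g → Σ∈ (grow x (ls , As)) g ≡
  g (x ∷ ls , As) +ℤ Σ∈ (pick ls) (λ (l , rest) → g (x ∷ rest , (l , x) ∷ As))
Σ-grow x ls As g = cong (g (x ∷ ls , As) +ℤ_) (Σ∈-map _ (pick ls) g)

grow-invariant : ∀ x {g} → Invariant g → Invariant (λ s → Σ∈ (grow x s) g)
grow-invariant x {g} inv {ls} {ls′} {As} {As′} p r = trans (Σ-grow x ls As g)
  (trans (cong₂ _+ℤ_ (inv (prep x p) r)
    (trans (Σ-pick-↭ p (λ (l , rest) → g (x ∷ rest , (l , x) ∷ As)) (λ l h → inv (prep x h) refl))
      (Σ∈-cong (pick ls′) (λ (l , rest) → inv refl (prep (l , x) r)))))
    (sym (Σ-grow x ls′ As′ g)))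

-- Passage from set partitions to states

last : List ℕ → ℕ
last [] = 0
last (a ∷ []) = a
last (a ∷ b ∷ r) = last (b ∷ r)

state : List (List ℕ) → State
state π = map last π , arcs π

-- Appending x to a block creates an arc from its last element only if there is one.
data NonEmpty : List ℕ → Set where
  nonEmpty : ∀ {a r} → NonEmpty (a ∷ r)

last-append : ∀ b x → last (b ++ [ x ]) ≡ x
last-append [] x = refl
last-append (a ∷ []) x = refl
last-append (a ∷ b ∷ r) x = last-append (b ∷ r) x

blockArcs-append : ∀ {b} x → NonEmpty b → blockArcs (b ++ [ x ]) ≡ blockArcs b ++ [ (last b , x) ]
blockArcs-append {a ∷ []} x nonEmpty = refl
blockArcs-append {a ∷ b ∷ r} x nonEmpty = cong ((a , b) ∷_) (blockArcs-append {b ∷ r} x nonEmpty)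

append-nonEmpty : ∀ b x → NonEmpty (b ++ [ x ])
append-nonEmpty [] x = nonEmpty
append-nonEmpty (a ∷ b) x = nonEmpty

addEach-nonEmpty : ∀ x {π} → All NonEmpty π → All (All NonEmpty) (addEach x π)
addEach-nonEmpty x [] = []
addEach-nonEmpty x {b ∷ π} (h ∷ hs) =
  (append-nonEmpty b x ∷ hs) ∷ All-map⁺ (All-map (λ hs′ → h ∷ hs′) (addEach-nonEmpty x hs))

setPartitions-nonEmpty : ∀ n → All (All NonEmpty) (setPartitions n)
setPartitions-nonEmpty zero = [] ∷ []
setPartitions-nonEmpty (suc n) =
  All-concatMap (λ h → (nonEmpty ∷ h) ∷ addEach-nonEmpty (suc n) h) (setPartitions-nonEmpty n)

-- The induction hypothesis is used for g with the block b put in front, which is again invariant;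
-- afterwards the extended block and the new arc are moved to the front past b.
Σ-addEach : ∀ x {π} → All NonEmpty π → ∀ {g} → Invariant g →
  Σ∈ (addEach x π) (g ∘ state) ≡ Σ∈ (pick (map last π)) (λ (l , rest) → g (x ∷ rest , (l , x) ∷ arcs π))
Σ-addEach x [] inv = refl
Σ-addEach x {b ∷ π} (h ∷ hs) {g} inv = begin
  g (last (b ++ [ x ]) ∷ map last π , blockArcs (b ++ [ x ]) ++ arcs π) +ℤ Σ∈ (map (b ∷_) (addEach x π)) (g ∘ state)
    ≡⟨ cong₂ _+ℤ_ first (Σ∈-map (b ∷_) (addEach x π) (g ∘ state)) ⟩
  g (x ∷ map last π , (last b , x) ∷ arcs (b ∷ π)) +ℤ Σ∈ (addEach x π) (λ ρ → g (last b ∷ map last ρ , blockArcs b ++ arcs ρ))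
    ≡⟨ cong (g (x ∷ map last π , (last b , x) ∷ arcs (b ∷ π)) +ℤ_)
        (Σ-addEach x hs (λ p r → inv (prep (last b) p) (++⁺ˡ (blockArcs b) r))) ⟩
  g (x ∷ map last π , (last b , x) ∷ arcs (b ∷ π)) +ℤ
    Σ∈ (pick (map last π)) (λ (l , rest) → g (last b ∷ x ∷ rest , blockArcs b ++ (l , x) ∷ arcs π))
    ≡⟨ cong (g (x ∷ map last π , (last b , x) ∷ arcs (b ∷ π)) +ℤ_)
        (Σ∈-cong (pick (map last π)) (λ (l , rest) → inv (swap (last b) x refl) (shift (l , x) (blockArcs b) (arcs π)))) ⟩
  g (x ∷ map last π , (last b , x) ∷ arcs (b ∷ π)) +ℤ
    Σ∈ (pick (map last π)) (λ (l , rest) → g (x ∷ last b ∷ rest , (l , x) ∷ arcs (b ∷ π)))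
    ≡⟨ Σ-pick-∷ (last b) (map last π) (λ (l , rest) → g (x ∷ rest , (l , x) ∷ arcs (b ∷ π))) ⟨
  Σ∈ (pick (map last (b ∷ π))) (λ (l , rest) → g (x ∷ rest , (l , x) ∷ arcs (b ∷ π))) ∎
  where
  open ≡-Reasoning
  first : g (last (b ++ [ x ]) ∷ map last π , blockArcs (b ++ [ x ]) ++ arcs π) ≡
    g (x ∷ map last π , (last b , x) ∷ arcs (b ∷ π))
  first = trans (cong₂ (λ l As → g (l ∷ map last π , As)) (last-append b x)
      (trans (cong (_++ arcs π) (blockArcs-append x h)) (Listₚ.++-assoc (blockArcs b) [ (last b , x) ] (arcs π))))
    (inv refl (shift (last b , x) (blockArcs b) (arcs π)))

Σ-setPartitions : ∀ n {g} → Invariant g → Σ∈ (setPartitions n) (g ∘ state) ≡ Σ∈ (states n) g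
Σ-setPartitions zero inv = refl
Σ-setPartitions (suc n) {g} inv = begin
  Σ∈ (setPartitions (suc n)) (g ∘ state)
    ≡⟨ Σ∈-concatMap (extend (suc n)) (setPartitions n) (g ∘ state) ⟩
  Σ∈ (setPartitions n) (λ π → Σ∈ (extend (suc n) π) (g ∘ state))
    ≡⟨ Σ∈-cong-All (All-map (λ {π} h → trans (cong (g (state ([ suc n ] ∷ π)) +ℤ_) (Σ-addEach (suc n) h inv))
        (sym (Σ-grow (suc n) (map last π) (arcs π) g))) (setPartitions-nonEmpty n)) ⟩
  Σ∈ (setPartitions n) (λ π → Σ∈ (grow (suc n) (state π)) g)
    ≡⟨ Σ-setPartitions n (grow-invariant (suc n) inv) ⟩
  Σ∈ (states n) (λ s → Σ∈ (grow (suc n) s) g)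
    ≡⟨ Σ∈-concatMap (grow (suc n)) (states n) g ⟨
  Σ∈ (states (suc n)) g ∎
  where open ≡-Reasoning

-- Newest block first, so that a new arc (l , n + 1) covers exactly the last elements that
-- precede l in the list.
record Valid (n : ℕ) (s : State) : Set where
  constructor valid
  field
    sorted : AllPairs (λ l l′ → l′ < l) (proj₁ s)
    bounded : All (_≤ n) (proj₁ s)
    arcs-bounded : All (λ α → proj₂ α ≤ n) (proj₂ s)
    size : length (proj₁ s) + length (proj₂ s) ≡ n

pick-All : ∀ {A : Set} {P : A → Set} {xs} → All P xs → All (λ (y , ys) → P y × All P ys) (pick xs)
pick-All [] = []
pick-All (p ∷ ps) = (p , ps) ∷ All-map⁺ (All-map (λ (r , rs) → r , p ∷ rs) (pick-All ps))

pick-sorted : ∀ {A : Set} {R : A → A → Set} {xs} → AllPairs R xs → All (λ (y , ys) → AllPairs R ys) (pick xs)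
pick-sorted [] = []
pick-sorted (r ∷ rs) = rs ∷ All-map⁺ (All-map (λ ((_ , r′) , rs′) → r′ ∷ rs′) (All-zip (pick-All r , pick-sorted rs)))

pick-length : ∀ {A : Set} (xs : List A) → All (λ (y , ys) → suc (length ys) ≡ length xs) (pick xs)
pick-length [] = []
pick-length (x ∷ xs) = refl ∷ All-map⁺ (All-map (cong suc) (pick-length xs))

grow-Valid : ∀ {n s} → Valid n s → All (Valid (suc n)) (grow (suc n) s)
grow-Valid {n} {ls , As} (valid sorted bounded arcs-bounded size) =
  valid (All-map s≤s bounded ∷ sorted) (ℕₚ.≤-refl ∷ All-map ℕₚ.m≤n⇒m≤1+n bounded)
    (All-map ℕₚ.m≤n⇒m≤1+n arcs-bounded) (cong suc size)
  ∷ All-map⁺ (All-map (λ ((_ , b) , s , e) →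
      valid (All-map s≤s b ∷ s) (ℕₚ.≤-refl ∷ All-map ℕₚ.m≤n⇒m≤1+n b)
        (ℕₚ.≤-refl ∷ All-map ℕₚ.m≤n⇒m≤1+n arcs-bounded)
        (trans (ℕₚ.+-suc _ (length As)) (cong suc (trans (cong (_+ length As) e) size))))
    (All-zip (pick-All bounded , All-zip (pick-sorted sorted , pick-length ls))))

states-Valid : ∀ n → All (Valid n) (states n)
states-Valid zero = valid [] [] [] refl ∷ []
states-Valid (suc n) = All-concatMap grow-Valid (states-Valid n)

exponents : State → List ℕ
exponents (ls , As) = map (covers As) ls

module _ (x : ℕ) (As : List Arc) where

  covers-before : ∀ l l′ → l′ < l → covers ((l , x) ∷ As) l′ ≡ covers As l′
  covers-before l l′ l′<l = trans (count-∷ (covering l′) (l , x) As)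
    (cong (λ b → b2n (b ∧ (l′ <ᵇ x)) + covers As l′) (<ᵇ-false (ℕₚ.<⇒≤ l′<l)))

  covers-after : ∀ l l′ → l < l′ → l′ < x → covers ((l , x) ∷ As) l′ ≡ suc (covers As l′)
  covers-after l l′ l<l′ l′<x = trans (count-∷ (covering l′) (l , x) As)
    (cong₂ (λ b c → b2n (b ∧ c) + covers As l′) (<ᵇ-true l<l′) (<ᵇ-true l′<x))

  covers-new : All (λ α → proj₂ α ≤ x) As → covers As x ≡ 0
  covers-new h = count-none (covering x) (All-map (λ {(a , c)} c≤x → ∧-falseʳ (a <ᵇ x) (<ᵇ-false c≤x)) h)

  pickExponents : ℕ × List ℕ → ℕ × List ℕ
  pickExponents (l , rest) = covers As l , map (covers ((l , x) ∷ As)) rest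

  pick-exponents : ∀ {ls} → AllPairs (λ l l′ → l′ < l) ls → All (_< x) ls →
    map pickExponents (pick ls) ≡ pickBump (map (covers As) ls)
  pick-exponents [] [] = refl
  pick-exponents {l₀ ∷ ls} (r ∷ rs) (b ∷ bs) = cong₂ _∷_
    (cong (covers As l₀ ,_) (Listₚ.map-cong-local (All-map (covers-before l₀ _) r)))
    (begin
      map pickExponents (map (λ (l , rest) → l , l₀ ∷ rest) (pick ls))
        ≡⟨ Listₚ.map-∘ (pick ls) ⟨
      map (λ (l , rest) → pickExponents (l , l₀ ∷ rest)) (pick ls)
        ≡⟨ Listₚ.map-cong-local (All-map
            (λ {(l , rest)} (l<l₀ , _) → cong (λ c → covers As l , c ∷ map (covers ((l , x) ∷ As)) rest) (covers-after l l₀ l<l₀ b))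
            (pick-All r)) ⟩
      map (λ (l , rest) → bumped (pickExponents (l , rest))) (pick ls)
        ≡⟨ Listₚ.map-∘ (pick ls) ⟩
      map bumped (map pickExponents (pick ls))
        ≡⟨ cong (map bumped) (pick-exponents rs bs) ⟩
      map bumped (pickBump (map (covers As) ls)) ∎)
    where
    open ≡-Reasoning
    bumped : ℕ × List ℕ → ℕ × List ℕ
    bumped (w , ys) = w , suc (covers As l₀) ∷ ys

-- The recurrence for the series of set partitions

module _ (φ : ℕ → ℤ) where

  stateTerm : ℕ → ℕ → ℕ → State → ℤ
  stateTerm m j a (ls , As) = when (length As ≡ᵇ m) (esp φ (exponents (ls , As)) j (a + crossings As))

  -- The new element n + 1 is always a last element covered by no arc, which yields the factor 1 +
  -- U, that is Y. Extending a block also removes its factor 1 + q^w U and creates w crossings,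
  -- which is one term of D on the product; together this is X = YD.
  Σ-grow-stateTerm : ∀ {n} m j a ls As → Valid n (ls , As) → Σ∈ (grow (suc n) (ls , As)) (stateTerm m j a) ≡
    when (suc (length As) ≡ᵇ m) (X (esp φ (exponents (ls , As))) j (a + crossings As)) +ℤ
    when (length As ≡ᵇ m) (Y (esp φ (exponents (ls , As))) j (a + crossings As))
  Σ-grow-stateTerm {n} m j a ls As (valid sorted bounded arcs-bounded size) = begin
    Σ∈ (grow x (ls , As)) (stateTerm m j a)
      ≡⟨ Σ-grow x ls As (stateTerm m j a) ⟩
    stateTerm m j a (x ∷ ls , As) +ℤ Σ∈ (pick ls) (λ (l , rest) → stateTerm m j a (x ∷ rest , (l , x) ∷ As))
      ≡⟨ cong₂ _+ℤ_ singleton extended ⟩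
    when (length As ≡ᵇ m) (Y (esp φ xs) j c) +ℤ when b (X (esp φ xs) j c)
      ≡⟨ ℤₚ.+-comm (when (length As ≡ᵇ m) (Y (esp φ xs) j c)) _ ⟩
    when b (X (esp φ xs) j c) +ℤ when (length As ≡ᵇ m) (Y (esp φ xs) j c) ∎
    where
    open ≡-Reasoning
    x = suc n
    xs = exponents (ls , As)
    c = a + crossings As
    b = suc (length As) ≡ᵇ m
    exchange : ∀ a w v → a + (w + v) ≡ (a + v) + w
    exchange = solve-∀ℕ
    esp-new : ∀ Bs ys → All (λ α → proj₂ α ≤ x) Bs → ∀ d → esp φ (covers Bs x ∷ ys) j d ≡ Y (esp φ ys) j d
    esp-new Bs ys h d = trans (cong (λ w → esp φ (w ∷ ys) j d) (covers-new x Bs h)) (esp-0∷ φ ys j d)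
    arcs-below : All (λ α → proj₂ α ≤ x) As
    arcs-below = All-map ℕₚ.m≤n⇒m≤1+n arcs-bounded
    singleton : stateTerm m j a (x ∷ ls , As) ≡ when (length As ≡ᵇ m) (Y (esp φ xs) j c)
    singleton = cong (when (length As ≡ᵇ m)) (esp-new As xs arcs-below c)
    term : ℕ × List ℕ → ℤ
    term (w , ys) = when b (Y (esp φ ys) j (c + w))
    extended : Σ∈ (pick ls) (λ (l , rest) → stateTerm m j a (x ∷ rest , (l , x) ∷ As)) ≡ when b (X (esp φ xs) j c)
    extended = begin
      Σ∈ (pick ls) (λ (l , rest) → stateTerm m j a (x ∷ rest , (l , x) ∷ As))
        ≡⟨ Σ∈-cong (pick ls) (λ (l , rest) → cong (when b) (trans
            (cong (esp φ (exponents (x ∷ rest , (l , x) ∷ As)) j)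
              (trans (cong (λ w → a + w) (crossings-∷ l x (All-map s≤s arcs-bounded))) (exchange a (covers As l) (crossings As))))
            (esp-new ((l , x) ∷ As) (map (covers ((l , x) ∷ As)) rest) (ℕₚ.≤-refl ∷ arcs-below) (c + covers As l)))) ⟩
      Σ∈ (pick ls) (term ∘ pickExponents x As)
        ≡⟨ Σ∈-map (pickExponents x As) (pick ls) term ⟨
      Σ∈ (map (pickExponents x As) (pick ls)) term
        ≡⟨ cong (λ zs → Σ∈ zs term) (pick-exponents x As sorted (All-map s≤s bounded)) ⟩
      Σ∈ (pickBump xs) term
        ≡⟨ Σ∈-when b (pickBump xs) (λ (w , ys) → Y (esp φ ys) j (c + w)) ⟩
      when b (Σ∈ (pickBump xs) (λ (w , ys) → Y (esp φ ys) j (c + w)))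
        ≡⟨ cong (when b) (trans (weighted-Y (pickBump xs) (λ _ → true) proj₁ (esp φ ∘ proj₂) j c)
            (Y-cong (esp-pickBump φ xs) j c)) ⟩
      when b (X (esp φ xs) j c) ∎

  stateSeries : ℕ → ℕ → Series
  stateSeries n m = weighted (states n) (λ s → length (proj₂ s) ≡ᵇ m) (crossings ∘ proj₂) (esp φ ∘ exponents)

  stateSeries-suc : ∀ n m j a → stateSeries (suc n) m j a ≡
    weighted (states n) (λ s → suc (length (proj₂ s)) ≡ᵇ m) (crossings ∘ proj₂) (X ∘ esp φ ∘ exponents) j a +ℤ
    Y (stateSeries n m) j a
  stateSeries-suc n m j a = begin
    Σ∈ (states (suc n)) (stateTerm m j a)
      ≡⟨ Σ∈-concatMap (grow (suc n)) (states n) (stateTerm m j a) ⟩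
    Σ∈ (states n) (λ s → Σ∈ (grow (suc n) s) (stateTerm m j a))
      ≡⟨ Σ∈-cong-All (All-map (λ {(ls , As)} → Σ-grow-stateTerm m j a ls As) (states-Valid n)) ⟩
    Σ∈ (states n) (λ s → when (suc (length (proj₂ s)) ≡ᵇ m) (X (esp φ (exponents s)) j (a + crossings (proj₂ s))) +ℤ
        when (length (proj₂ s) ≡ᵇ m) (Y (esp φ (exponents s)) j (a + crossings (proj₂ s))))
      ≡⟨ Σ∈-+ (states n) _ _ ⟩
    e j a +ℤ weighted (states n) (λ s → length (proj₂ s) ≡ᵇ m) (crossings ∘ proj₂) (Y ∘ esp φ ∘ exponents) j a
      ≡⟨ cong (e j a +ℤ_) (weighted-Y (states n) (λ s → length (proj₂ s) ≡ᵇ m) (crossings ∘ proj₂) (esp φ ∘ exponents) j a) ⟩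
    e j a +ℤ Y (stateSeries n m) j a ∎
    where
    open ≡-Reasoning
    e = weighted (states n) (λ s → suc (length (proj₂ s)) ≡ᵇ m) (crossings ∘ proj₂) (X ∘ esp φ ∘ exponents)

  stateSeries≈words : ∀ n m → stateSeries n m ≈ words X Y (one φ) n m
  stateSeries≈words zero zero j a = trans (ℤₚ.+-identityʳ _) (cong (one φ j) (ℕₚ.+-identityʳ a))
  stateSeries≈words zero (suc m) j a = refl
  stateSeries≈words (suc n) zero j a = trans (stateSeries-suc n zero j a)
    (trans (cong (_+ℤ Y (stateSeries n zero) j a) (Σ∈-zero (states n)))
      (trans (ℤₚ.+-identityˡ _) (Y-cong (stateSeries≈words n zero) j a)))
  stateSeries≈words (suc n) (suc m) j a = trans (stateSeries-suc n (suc m) j a)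
    (cong₂ _+ℤ_
      (trans (weighted-Y (states n) b (crossings ∘ proj₂) (D ∘ esp φ ∘ exponents) j a)
        (Y-cong (λ i c → trans (weighted-D (states n) b (crossings ∘ proj₂) (esp φ ∘ exponents) i c)
          (D-cong (stateSeries≈words n m) i c)) j a))
      (Y-cong (stateSeries≈words n (suc m)) j a))
    where
    b : State → Bool
    b s = length (proj₂ s) ≡ᵇ m

S₂≡words : ∀ m k d → S₂ (m + k) k d ≡ words X Y (one (δ d)) (m + k) m 0 0
S₂≡words m k d = begin
  S₂ (m + k) k d
    ≡⟨ Σ∈-indicator (λ π → (length π ≡ᵇ k) ∧ (cro π ≡ᵇ d)) (setPartitions (m + k)) ⟩
  Σ∈ (setPartitions (m + k)) (λ π → + b2n ((length π ≡ᵇ k) ∧ (cro π ≡ᵇ d)))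
    ≡⟨ Σ∈-cong (setPartitions (m + k)) (λ π → cong (λ l → + b2n ((l ≡ᵇ k) ∧ (cro π ≡ᵇ d))) (sym (Listₚ.length-map last π))) ⟩
  Σ∈ (setPartitions (m + k)) (g ∘ state)
    ≡⟨ Σ-setPartitions (m + k) g-invariant ⟩
  Σ∈ (states (m + k)) g
    ≡⟨ Σ∈-cong-All (All-map (λ {(ls , As)} → term ls As) (states-Valid (m + k))) ⟩
  stateSeries (δ d) (m + k) m 0 0
    ≡⟨ stateSeries≈words (δ d) (m + k) m 0 0 ⟩
  words X Y (one (δ d)) (m + k) m 0 0 ∎
  where
  open ≡-Reasoning
  g : State → ℤ
  g (ls , As) = + b2n ((length ls ≡ᵇ k) ∧ (crossings As ≡ᵇ d))
  g-invariant : Invariant g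
  g-invariant p r = cong₂ (λ x y → + b2n ((x ≡ᵇ k) ∧ (y ≡ᵇ d))) (↭-length p) (crossings-↭ r)
  term : ∀ ls As → Valid (m + k) (ls , As) → g (ls , As) ≡ stateTerm (δ d) m 0 0 (ls , As)
  term ls As v = trans (b2n-∧ (length ls ≡ᵇ k) (crossings As ≡ᵇ d))
    (cong₂ when (≡ᵇ-complement (length ls) k (trans (Valid.size v) (ℕₚ.+-comm m k)))
      (sym (esp-zero (δ d) (exponents (ls , As)) (crossings As))))

-- Interpolation of t ↦ H m t at the points -m, …, m

iterDown : ℕ → ℤ → ℤ
iterDown zero t = t
iterDown (suc x) t = down (iterDown x t)

Degree<⇒Δ^≡0 : ∀ {d f} → Degree< d f → ∀ t x → Δ^ d (λ y → f (iterDown y t)) x ≡ + 0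
Degree<⇒Δ^≡0 (zero p) t x = p (iterDown x t)
Degree<⇒Δ^≡0 (suc p) t x = Degree<⇒Δ^≡0 p t x

iterDown-nonneg : ∀ x j → iterDown x (+ (x + j)) ≡ + j
iterDown-nonneg zero j = refl
iterDown-nonneg (suc x) j = cong down
  (trans (cong (λ y → iterDown x (+ y)) (sym (ℕₚ.+-suc x j))) (iterDown-nonneg x (suc j)))

iterDown-neg : ∀ i m → iterDown (suc i + m) (+ m) ≡ -[1+ i ]
iterDown-neg zero m = cong down
  (trans (cong (λ y → iterDown m (+ y)) (sym (ℕₚ.+-identityʳ m))) (iterDown-nonneg m 0))
iterDown-neg (suc i) m = cong down (iterDown-neg i m)

double≡+ : ∀ m → double m + 0 ≡ m + m
double≡+ zero = refl
double≡+ (suc m) = cong suc (trans (cong suc (double≡+ m)) (sym (ℕₚ.+-suc m m)))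

neg1^-+ : ∀ i j → neg1^ (i + j) ≡ neg1^ i *ℤ neg1^ j
neg1^-+ zero j = sym (ℤₚ.*-identityˡ (neg1^ j))
neg1^-+ (suc i) j = trans (cong (-[1+ 0 ] *ℤ_) (neg1^-+ i j)) (sym (ℤₚ.*-assoc -[1+ 0 ] (neg1^ i) (neg1^ j)))

neg1^-square : ∀ i → neg1^ i *ℤ neg1^ i ≡ + 1
neg1^-square zero = refl
neg1^-square (suc i) = trans (signs (neg1^ i)) (neg1^-square i)
  where
  signs : ∀ s → (-[1+ 0 ] *ℤ s) *ℤ (-[1+ 0 ] *ℤ s) ≡ s *ℤ s
  signs = solve-∀

module _ (φ : ℕ → ℤ) (m p : ℕ) (m≤1+p : m ≤ suc p) where

  private
    -- The nodes are numbered downward from t = m: the indices 0, ..., m are t = m, ..., 0, the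
    -- indices m + 1, ..., 2m are t = -1, ..., -m, and t = -(p + 1) has index `N`.
    u : ℕ → ℤ
    u x = H φ m (iterDown x (+ m)) 0 0

    N : ℕ
    N = suc p + m

    term : ℕ → ℤ
    term j = (neg1^ j *ℤ + (((p + j) C (m + j)) * (N C (m ∸ j)))) *ℤ words X Y (one φ) (m + j) m 0 0

  u-vanishes : ∀ x → Δ^ (suc (m + m)) u x ≡ + 0
  u-vanishes x = subst (λ d → Δ^ (suc d) u x ≡ + 0) (double≡+ m) (Degree<⇒Δ^≡0 (H-degree φ m 0 0) (+ m) x)

  term-zero : ∀ i → i < m → lagrange-term N (m + m) u (suc m + i) ≡ + 0
  term-zero i i<m = trans
    (cong (λ z → neg1^ (m + m) *ℤ (c *ℤ z)) (trans (cong (λ t → H φ m t 0 0) index) (vanish m i<m)))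
    (trans (cong (neg1^ (m + m) *ℤ_) (ℤₚ.*-zeroʳ c)) (ℤₚ.*-zeroʳ (neg1^ (m + m))))
    where
    c = neg1^ (suc m + i) *ℤ + ((N C (suc m + i)) * ((N ∸ 1 ∸ (suc m + i)) C (m + m ∸ (suc m + i))))
    index : iterDown (suc m + i) (+ m) ≡ -[1+ i ]
    index = trans (cong (λ x → iterDown (suc x) (+ m)) (ℕₚ.+-comm m i)) (iterDown-neg i m)
    vanish : ∀ m → i < m → H φ m -[1+ i ] 0 0 ≡ + 0
    vanish (suc m) i<1+m = wordsEZ-zero φ (suc i) m i<1+m 0 0

  -- The index m - j is the node t = j. The leading sign (-1)^(2m) is 1, and (-1)^(m-j) = (-1)^m
  -- (-1)^j gives the two signs of the theorem.
  term-reversed : ∀ j → j < suc m → lagrange-term N (m + m) u (m ∸ j) ≡ neg1^ m *ℤ term j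
  term-reversed j (s≤s j≤m) = begin
    neg1^ (m + m) *ℤ (neg1^ i *ℤ + ((N C i) * ((p + m ∸ i) C (m + m ∸ i))) *ℤ u i)
      ≡⟨ cong₂ (λ b y → neg1^ (m + m) *ℤ (neg1^ i *ℤ + b *ℤ y)) binomials
          (cong (λ t → H φ m t 0 0) (trans (cong (λ x → iterDown i (+ x)) (sym i+j≡m)) (iterDown-nonneg i j))) ⟩
    neg1^ (m + m) *ℤ (neg1^ i *ℤ + b *ℤ w)
      ≡⟨ cong (_*ℤ (neg1^ i *ℤ + b *ℤ w)) (trans (neg1^-+ m m) (neg1^-square m)) ⟩
    + 1 *ℤ (neg1^ i *ℤ + b *ℤ w)
      ≡⟨ insert (neg1^ i) (+ b) w ⟩
    (neg1^ i *ℤ + 1) *ℤ (+ b *ℤ w)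
      ≡⟨ cong (λ z → (neg1^ i *ℤ z) *ℤ (+ b *ℤ w)) (sym (neg1^-square j)) ⟩
    (neg1^ i *ℤ (neg1^ j *ℤ neg1^ j)) *ℤ (+ b *ℤ w)
      ≡⟨ regroup (neg1^ i) (neg1^ j) (+ b) w ⟩
    (neg1^ i *ℤ neg1^ j) *ℤ ((neg1^ j *ℤ + b) *ℤ w)
      ≡⟨ cong (_*ℤ ((neg1^ j *ℤ + b) *ℤ w)) (trans (sym (neg1^-+ i j)) (cong neg1^ i+j≡m)) ⟩
    neg1^ m *ℤ term j ∎
    where
    open ≡-Reasoning
    i = m ∸ j
    b = ((p + j) C (m + j)) * (N C i)
    w = words X Y (one φ) (m + j) m 0 0
    i+j≡m : i + j ≡ m
    i+j≡m = ℕₚ.m∸n+n≡m j≤m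
    subtract : ∀ x → x + m ∸ i ≡ x + j
    subtract x = trans (ℕₚ.+-∸-assoc x (ℕₚ.m∸n≤m m j)) (cong (λ y → x + y) (ℕₚ.m∸[m∸n]≡n j≤m))
    binomials : (N C i) * ((p + m ∸ i) C (m + m ∸ i)) ≡ b
    binomials = trans (cong₂ (λ x y → (N C i) * (x C y)) (subtract p) (subtract m))
      (ℕₚ.*-comm (N C i) ((p + j) C (m + j)))
    insert : ∀ s b w → + 1 *ℤ (s *ℤ b *ℤ w) ≡ (s *ℤ + 1) *ℤ (b *ℤ w)
    insert = solve-∀
    regroup : ∀ s t b w → (s *ℤ (t *ℤ t)) *ℤ (b *ℤ w) ≡ (s *ℤ t) *ℤ ((t *ℤ b) *ℤ w)
    regroup = solve-∀

  wordsEZ≡Σ-wordsXY : words E Z (one φ) (suc p) m 0 0 ≡ neg1^ m *ℤ Σ< (suc m) term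
  wordsEZ≡Σ-wordsXY = begin
    words E Z (one φ) (suc p) m 0 0
      ≡⟨ cong (λ t → H φ m t 0 0) (iterDown-neg p m) ⟨
    u N
      -- The bound m ≤ p + 1 places the index `N` at or beyond the last node 2m.
      ≡⟨ lagrange (m + m) u u-vanishes (ℕₚ.+-monoˡ-≤ m m≤1+p) ⟩
    Σ< (suc m + m) l
      ≡⟨ Σ<-split (suc m) m l ⟩
    Σ< (suc m) l +ℤ Σ< m (λ i → l (suc m + i))
      ≡⟨ cong (Σ< (suc m) l +ℤ_) (trans (Σ<-cong< m term-zero) (Σ<-zero m)) ⟩
    Σ< (suc m) l +ℤ + 0
      ≡⟨ ℤₚ.+-identityʳ _ ⟩
    Σ< (suc m) l
      ≡⟨ Σ<-reverse m l ⟩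
    Σ< (suc m) (λ j → l (m ∸ j))
      ≡⟨ Σ<-cong< (suc m) term-reversed ⟩
    Σ< (suc m) (λ j → neg1^ m *ℤ term j)
      ≡⟨ Σ<-*ˡ (suc m) (neg1^ m) term ⟩
    neg1^ m *ℤ Σ< (suc m) term ∎
    where
    open ≡-Reasoning
    l : ℕ → ℤ
    l = lagrange-term N (m + m) u

ΣP≡Σ< : ∀ m f d → ΣP m f d ≡ Σ< (suc m) (λ j → f j d)
ΣP≡Σ< m f d = trans (evaluate (upTo (suc m))) (Σ∈-applyUpTo id (suc m) (λ j → f j d))
  where
  evaluate : ∀ js → foldr (λ j acc → f j ⊕ acc) 0P js d ≡ Σ∈ js (λ j → f j d)
  evaluate [] = refl
  evaluate (j ∷ js) = cong (f j d +ℤ_) (evaluate js)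

theorem6p1 : (n k : ℕ) → k ≤ n → (d : ℕ) →
    S₁ n k d ≡
    (neg1^ (n ∸ k) ⊙ ΣP (n ∸ k) (λ j →
    (neg1^ j *ℤ (+ (((n ∸ 1 + j) C (n ∸ k + j)) * ((2 * n ∸ k) C (n ∸ k ∸ j)))))
    ⊙ S₂ (n ∸ k + j) j)) d
-- Interpolation reaches S₁ at negative t = -n only, so n = 0 is computed: with n ∸ 1 truncated to
-- 0, both sides are the polynomial 1.
theorem6p1 zero .zero z≤n zero = refl
theorem6p1 zero .zero z≤n (suc d) = refl
theorem6p1 (suc p) k k≤n d = begin
  S₁ (suc p) k d
    ≡⟨ cong (λ n → S₁ n k d) (sym m+k≡n) ⟩
  S₁ (m + k) k d
    ≡⟨ S₁≡words m k d ⟩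
  words E Z (one (δ d)) (m + k) m 0 0
    ≡⟨ cong (λ n → words E Z (one (δ d)) n m 0 0) m+k≡n ⟩
  words E Z (one (δ d)) (suc p) m 0 0
    ≡⟨ wordsEZ≡Σ-wordsXY (δ d) m p (ℕₚ.m∸n≤m (suc p) k) ⟩
  neg1^ m *ℤ Σ< (suc m) (λ j →
    (neg1^ j *ℤ + (((p + j) C (m + j)) * ((suc p + m) C (m ∸ j)))) *ℤ words X Y (one (δ d)) (m + j) m 0 0)
    ≡⟨ cong (neg1^ m *ℤ_) (Σ<-cong (suc m) (λ j → cong₂ (λ N z →
        (neg1^ j *ℤ + (((p + j) C (m + j)) * (N C (m ∸ j)))) *ℤ z) (sym 2n∸k≡n+m) (sym (S₂≡words m j d)))) ⟩
  neg1^ m *ℤ Σ< (suc m) (λ j → summand j d)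
    ≡⟨ cong (neg1^ m *ℤ_) (sym (ΣP≡Σ< m summand d)) ⟩
  (neg1^ m ⊙ ΣP m summand) d ∎
  where
  open ≡-Reasoning
  m = suc p ∸ k
  m+k≡n : m + k ≡ suc p
  m+k≡n = ℕₚ.m∸n+n≡m k≤n
  2n∸k≡n+m : 2 * suc p ∸ k ≡ suc p + m
  2n∸k≡n+m = trans (cong (λ n → suc p + n ∸ k) (ℕₚ.+-identityʳ (suc p))) (ℕₚ.+-∸-assoc (suc p) k≤n)
  summand : ℕ → Poly
  summand j = (neg1^ j *ℤ (+ (((p + j) C (m + j)) * ((2 * suc p ∸ k) C (m ∸ j))))) ⊙ S₂ (m + j) j
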